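{- Let $m,d\ge1$ be coprime integers. Then the number of partitions that are simultaneously $m$-cores, $(m+d)$-cores and $(m+2d)$-cores is $$\sum_{\lambda\in \mathcal{C}_m\cap\mathcal{C}_{m+d}\cap\mathcal{C}_{m+2d}} 1 = \frac{1}{m+d}\sum_{i=0}^{\lfloor m/2\rfloor}\binom{m+d}{i,\,i+d,\,m-2i}.$$
   Context: A partition is an infinite weakly decreasing sequence $\lambda=(\lambda_1,\lambda_2,\ldots)$ of nonnegative integers with finite sum. Its Young diagram is $[\lambda]=\{(r,c)\in\mathbb{Z}_{>0}^2 : c\le\lambda_r\}$, its conjugate $\overline{\lambda}$ is given by $\overline{\lambda}_r=\#\{c\in\mathbb{Z}_{>0}: r\le\lambda_c\}$, and the hook length at $(r,c)\in[\lambda]$ is $1+(\lambda_r-r)+(\overline{\lambda}_c-c)$. For $s\ge1$, a partition is an $s$-core if it has no hook of length $s$; $\mathcal{C}_s$ is the set of $s$-cores. The symbol $\binom{n}{a,b,c}=\frac{n!}{a!\,b!\,c!}$ (with $a+b+c=n$) is a multinomial coefficient. -}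

module Defs where

open import Data.Fin.Base using (Fin)
open import Data.Integer.Base as ℤ using (ℤ; +_; _⊖_)
open import Data.List.Base using (applyUpTo; filter; length; map; upTo)
open import Data.Nat.Base
open import Data.Nat.DivMod using (_/_)
open import Data.Nat.ListAction using (sum)
open import Data.Nat.Properties using (_<?_; _!≢0; m*n≢0)
open import Data.Product.Base using (Σ-syntax; _×_; _,_; proj₁)
open import Function.Bundles using (Inverse)
open import Relation.Binary.Bundles using (Setoid)
import Relation.Binary.Construct.On as On
open import Relation.Binary.PropositionalEquality using (_≢_; setoid; _→-setoid_)

-- Rows and columns are indexed from 0: parts r is λ_{r+1}.
-- Finiteness of the sum is boundedness of the partial sums.
record Partition : Set where
  field
    parts      : ℕ → ℕ
    decreasing : ∀ r → parts (suc r) ≤ parts r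
    bound      : ℕ
    finiteSum  : ∀ n → sum (applyUpTo parts n) ≤ bound

open Partition public

-- Two partitions are equal when all their parts agree; the choice of bound
-- is irrelevant.
partitionSetoid : Setoid _ _
partitionSetoid = On.setoid (ℕ →-setoid ℕ) parts

_∈[_] : ℕ × ℕ → Partition → Set
(r , c) ∈[ p ] = c < parts p r

-- The number of r : ℕ with c < parts p r.  Every such r lies below bound p,
-- since then parts 0, …, r are all positive and so suc r ≤ bound p.
conjugate : Partition → ℕ → ℕ
conjugate p c = length (filter (λ r → c <? parts p r) (upTo (bound p)))

-- Integer subtraction is needed: each of the two differences can be negative
-- on its own.  The successors turn the 0-based r and c into 1-based ones.
hookLength : Partition → ℕ × ℕ → ℤ
hookLength p (r , c) =
  + 1 ℤ.+ (parts p r ⊖ suc r) ℤ.+ (conjugate p c ⊖ suc c)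

IsCore : ℕ → Partition → Set
IsCore s p = ∀ rc → rc ∈[ p ] → hookLength p rc ≢ + s

SimultaneousCore : ℕ → ℕ → ℕ → Set
SimultaneousCore s t u = Σ[ p ∈ Partition ] (IsCore s p × IsCore t p × IsCore u p)

simultaneousCores : ℕ → ℕ → ℕ → Setoid _ _
simultaneousCores s t u =
  On.setoid {B = SimultaneousCore s t u} partitionSetoid proj₁

HasCardinality : ∀ {a ℓ} → Setoid a ℓ → ℕ → Set _
HasCardinality S n = Inverse S (setoid (Fin n))

-- Only meaningful when a + b + c ≡ n, in which case the division is exact.
multinomial : (n a b c : ℕ) → ℕ
multinomial n a b c = n ! / (a ! * b ! * c !)
  where
  instance
    _ = a !≢0
    _ = b !≢0
    _ = c !≢0
    _ = m*n≢0 (a !) (b !)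
    _ = m*n≢0 (a ! * b !) (c !)

sumUpTo : ℕ → (ℕ → ℕ) → ℕ
sumUpTo n f = sum (map f (upTo (suc n)))

syntax sumUpTo n (λ i → e) = ∑[0≤ i ≤ n ] e

instance
  m+n≢0 : ∀ {m n} .{{_ : NonZero m}} → NonZero (m + n)
  m+n≢0 {suc _} = _

{-# OPTIONS --safe #-}

-- Number the steps of the boundary path of a partition from its first horizontal step,
-- and let S be the set of numbers of horizontal steps.  A hook of length s joins a
-- horizontal step x to a vertical step x + s, so the partition is an s-core exactly when
-- S + s ⊆ S.  Put n = m + d.  If S is closed under adding m, n and n + d, let b_k be its
-- least element in the class of k d modulo n; then b_{k+1} - b_k is one of d + n, d, d - n,
-- and the steps b_0 = 0, b_1, …, b_n = 0 determine S.  Thus the cores correspond to the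
-- closed walks of n such steps that start at 0 and never go below 0.  A word of n steps
-- returns to its start exactly when it has d more steps d - n than steps d + n, and exactly
-- one of its n rotations stays above its start: the one that starts at the minimum, which
-- is unique because n consecutive heights are distinct modulo n.
module Submission where

open import Defs
open import Data.Fin.Base using (Fin)
open import Data.Integer.Base as ℤ using (1ℤ; +_; _⊖_)
import Data.Integer.Properties as ℤ
import Data.Integer.Tactic.RingSolver as ℤ-Solver
open import Data.List.Base
  using (List; []; _∷_; _++_; applyUpTo; concatMap; drop; filter; length; map; take; upTo)
open import Data.List.Membership.Propositional using (_∈_; find; lose)
open import Data.List.Membership.Propositional.Properties
open import Data.List.Membership.Propositional.Properties.WithK
  using (unique⇒irrelevant; unique∧set⇒bag)
open import Data.List.Properties
  using (++-assoc; ++-identityʳ; length-++; length-++-comm; length-applyUpTo; length-drop;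
         length-map; length-take; map-++; map-cong-local; take++drop≡id; ∷-injective)
open import Data.List.Relation.Binary.BagAndSetEquality using (∼bag⇒↭)
open import Data.List.Relation.Binary.Permutation.Propositional.Properties using (↭-length)
open import Data.List.Relation.Unary.All as All using (All; []; _∷_)
open import Data.List.Relation.Unary.All.Properties using (all-upTo)
open import Data.List.Relation.Unary.AllPairs using ([]; _∷_)
open import Data.List.Relation.Unary.Any as Any using (Any; here; there; index)
open import Data.List.Relation.Unary.Any.Properties using (lookup-index)
open import Data.List.Relation.Unary.Unique.Propositional using (Unique)
import Data.List.Relation.Unary.Unique.Propositional.Properties as Unique
open import Data.Nat.Base as ℕ hiding (_/_)
open import Data.Nat.Coprimality as Coprime
  using (Coprime; coprime-+; coprime-Bézout; coprime-divisor)
open import Data.Nat.Divisibility using (divides; ∣⇒≤)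
open import Data.Nat.DivMod hiding (_/_)
open import Data.Nat.GCD using (module Bézout)
open import Data.Nat.ListAction using (sum)
open import Data.Nat.ListAction.Properties using (sum-++)
open import Data.Nat.Properties
open import Data.Nat.Tactic.RingSolver using (solve-∀)
open import Data.Product.Base using (∃-syntax; Σ-syntax; _×_; _,_; proj₁; proj₂)
open import Data.Rational.Base as ℚ using (_/_; toℚᵘ)
import Data.Rational.Properties as ℚ
open import Data.Rational.Unnormalised.Base as ℚᵘ using (mkℚᵘ; *≡*)
import Data.Rational.Unnormalised.Properties as ℚᵘ
open import Data.Sum.Base using (_⊎_; inj₁; inj₂)
open import Function.Base using (id; _∘_)
open import Function.Bundles using (mk⇔)
open import Level using (0ℓ)
open import Relation.Binary.Bundles using (Setoid)
open import Relation.Binary.Definitions using (tri<; tri≈; tri>)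
open import Relation.Binary.PropositionalEquality
open import Relation.Nullary using (¬_; Dec; yes; no)
open import Relation.Nullary.Decidable using (_×-dec_; map′)
open import Relation.Nullary.Negation using (contradiction)
open import Relation.Unary using (Pred; Decidable)

-- The three differences come from two inequalities. Adding n + d to b_k lands in the class of
-- b_{k+1}, so b_{k+1} ≤ b_k + d + n. Adding m, which is -d modulo n, to b_{k+1} lands in the class
-- of b_k, so b_{k+1} ≥ b_k + d - n. Between these bounds the class leaves only three values. Read
-- backwards, the same inequalities show that the set described by a walk is closed under adding m
-- and n + d; closure under n is built into that set. To come from a partition the set must also
-- have a finite complement: as m and n are coprime, the numbers k m + t n include everything from n
-- m on. Numbering from the first horizontal step puts 0 into S and removes the freedom to translate
-- a boundary path, so equal sets give equal partitions. Heights are natural numbers, so that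
-- staying above 0 is part of the type of walks; equations that would subtract are stated with both
-- sides moved to sums.

/1≡1/*/1 : ∀ N n {M} .{{_ : NonZero n}} → N * n ≡ M → (+ N) / 1 ≡ (1ℤ / n) ℚ.* ((+ M) / 1)
/1≡1/*/1 N (suc n) {M} eq = ℚ.toℚᵘ-injective (begin
  toℚᵘ ((+ N) / 1)                              ≈⟨ ℚ.toℚᵘ-fromℚᵘ (mkℚᵘ (+ N) 0) ⟩
  mkℚᵘ (+ N) 0                                  ≈⟨ *≡* cross ⟩
  mkℚᵘ 1ℤ n ℚᵘ.* mkℚᵘ (+ M) 0                   ≈⟨ ℚᵘ.*-cong (ℚ.toℚᵘ-fromℚᵘ (mkℚᵘ 1ℤ n)) (ℚ.toℚᵘ-fromℚᵘ (mkℚᵘ (+ M) 0)) ⟨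
  toℚᵘ (1ℤ / suc n) ℚᵘ.* toℚᵘ ((+ M) / 1)       ≈⟨ ℚ.toℚᵘ-homo-* (1ℤ / suc n) ((+ M) / 1) ⟨
  toℚᵘ ((1ℤ / suc n) ℚ.* ((+ M) / 1))           ∎)
  where
  open ℚᵘ.≃-Reasoning
  cross : + N ℤ.* + suc (n * 1) ≡ 1ℤ ℤ.* + M ℤ.* 1ℤ
  cross = trans (cong (λ k → + N ℤ.* + suc k) (*-identityʳ n))
    (trans (sym (ℤ.pos-* N (suc n)))
      (trans (cong +_ eq) (sym (trans (ℤ.*-identityʳ _) (ℤ.*-identityˡ (+ M))))))

-- Partitions as boundary paths

module _ {P : ℕ → Set} (P? : Decidable P) where

  -- `P` is downward closed along `f`, so the entries that pass the filter form an initial segment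
  -- and the length of the filtered list is its threshold. For the conjugate this yields: `r < λ′ c`
  -- exactly when `c < parts p r`.
  <length-filter⇒ : ∀ (f : ℕ → ℕ) N → (∀ r → P (f (suc r)) → P (f r)) →
    ∀ {r} → r < length (filter P? (applyUpTo f N)) → P (f r)
  <length-filter⇒ f (suc N) down r< with P? (f 0)
  <length-filter⇒ f (suc N) down {zero}  r<       | yes p = p
  <length-filter⇒ f (suc N) down {suc r} (s<s r<) | yes _ =
    <length-filter⇒ (f ∘ suc) N (down ∘ suc) r<
  <length-filter⇒ f (suc N) down {r}     r<       | no _  =
    down r (<length-filter⇒ (f ∘ suc) N (down ∘ suc) r<)

  <length-filter⇐ : ∀ (f : ℕ → ℕ) N → (∀ r → P (f (suc r)) → P (f r)) →
    ∀ {r} → r < N → P (f r) → r < length (filter P? (applyUpTo f N))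
  <length-filter⇐ f (suc N) down {r} r<N p with P? (f 0)
  <length-filter⇐ f (suc N) down {zero}  r<N       p | yes _  = z<s
  <length-filter⇐ f (suc N) down {suc r} (s<s r<N) p | yes _  =
    s<s (<length-filter⇐ (f ∘ suc) N (down ∘ suc) r<N p)
  <length-filter⇐ f (suc N) down {r}     r<N       p | no ¬p₀ =
    contradiction (descend r p) ¬p₀
    where
    descend : ∀ r → P (f r) → P (f 0)
    descend zero    = id
    descend (suc r) = descend r ∘ down r

length≤sum : ∀ (f : ℕ → ℕ) n → (∀ r → r < n → 0 < f r) → n ≤ sum (applyUpTo f n)
length≤sum f zero    pos = z≤n
length≤sum f (suc n) pos =
  +-mono-≤ (pos 0 z<s) (length≤sum (f ∘ suc) n (λ r r<n → pos (suc r) (s<s r<n)))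

antitone : ∀ {f : ℕ → ℕ} → (∀ r → f (suc r) ≤ f r) → ∀ {r s} → r ≤ s → f s ≤ f r
antitone {f} step r≤s = go (≤⇒≤′ r≤s)
  where
  go : ∀ {r s} → r ≤′ s → f s ≤ f r
  go ≤′-refl       = ≤-refl
  go (≤′-step r≤s) = ≤-trans (step _) (go r≤s)

≡-by-< : ∀ {a b} → (∀ r → r < a → r < b) → (∀ r → r < b → r < a) → a ≡ b
≡-by-< {a} {b} to from with <-cmp a b
... | tri< a<b _ _ = contradiction (from a a<b) (<-irrefl refl)
... | tri≈ _ a≡b _ = a≡b
... | tri> _ _ b<a = contradiction (to b b<a) (<-irrefl refl)

module _ (p : Partition) where

  private
    λ′ : ℕ → ℕ
    λ′ = conjugate p

  <-conjugate⇒ : ∀ {r c} → r < λ′ c → c < parts p r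
  <-conjugate⇒ {c = c} = <length-filter⇒ (λ r → c <? parts p r) id (bound p)
    (λ r c< → <-≤-trans c< (decreasing p r))

  <-conjugate⇐ : ∀ {r c} → c < parts p r → r < λ′ c
  <-conjugate⇐ {r} {c} c< = <length-filter⇐ (λ r → c <? parts p r) id (bound p)
    (λ r c< → <-≤-trans c< (decreasing p r)) r<bound c<
    where
    r<bound : r < bound p
    r<bound = ≤-trans
      (length≤sum (parts p) (suc r) (λ i i<1+r →
        <-≤-trans (≤-<-trans z≤n c<) (antitone (decreasing p) (s≤s⁻¹ i<1+r))))
      (finiteSum p (suc r))

  conjugate-decreasing : ∀ c → λ′ (suc c) ≤ λ′ c
  conjugate-decreasing c = ≮⇒≥ λ λ′c< →
    <-irrefl refl (<-conjugate⇐ (<-trans (n<1+n c) (<-conjugate⇒ λ′c<)))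

  conjugate≤conjugate₀ : ∀ c → λ′ c ≤ λ′ 0
  conjugate≤conjugate₀ c = antitone conjugate-decreasing z≤n

  conjugate-vanishes : ∀ {c} → parts p 0 ≤ c → λ′ c ≡ 0
  conjugate-vanishes {c} p₀≤c with λ′ c in eq
  ... | zero  = refl
  ... | suc _ = contradiction (<-conjugate⇒ (subst (0 <_) (sym eq) z<s)) (≤⇒≯ p₀≤c)

  -- The boundary path of the diagram, numbered from its first horizontal step:
  -- the horizontal step of column c is number c + λ′ 0 ∸ λ′ c, the vertical step of
  -- row r is number parts r + λ′ 0 ∸ suc r.
  Horizontal Vertical : ℕ → Set
  Horizontal x = ∃[ c ] x + λ′ c ≡ c + λ′ 0
  Vertical   x = ∃[ r ] r < λ′ 0 × x + suc r ≡ parts p r + λ′ 0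

  column : ℕ → ℕ
  column c = c + λ′ 0 ∸ λ′ c

  column-horizontal : ∀ c → column c + λ′ c ≡ c + λ′ 0
  column-horizontal c =
    m∸n+n≡m (≤-trans (conjugate≤conjugate₀ c) (m≤n+m _ c))

  column-mono-< : ∀ {c c′} → c < c′ → column c < column c′
  column-mono-< {c} {c′} c<c′ = +-cancelʳ-< (λ′ c) (column c) (column c′) (begin-strict
    column c + λ′ c    ≡⟨ column-horizontal c ⟩
    c + λ′ 0           <⟨ +-monoˡ-< (λ′ 0) c<c′ ⟩
    c′ + λ′ 0          ≡⟨ column-horizontal c′ ⟨
    column c′ + λ′ c′  ≤⟨ +-monoʳ-≤ (column c′) (antitone conjugate-decreasing (<⇒≤ c<c′)) ⟩
    column c′ + λ′ c   ∎)
    where open ≤-Reasoning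

  column-locate : ∀ x → ∃[ c ] column c ≤ x × x < column (suc c)
  column-locate zero = 0 , ≤-reflexive (n∸n≡0 (λ′ 0)) , ≤-<-trans z≤n (column-mono-< z<s)
  column-locate (suc x) with c , ≤x , x< ← column-locate x | suc x <? column (suc c)
  ... | yes 1+x< = c , m≤n⇒m≤1+n ≤x , 1+x<
  ... | no  1+x≮ = suc c , ≮⇒≥ 1+x≮ , ≤-<-trans x< (column-mono-< (n<1+n (suc c)))

  -- Between the horizontal steps of columns `c` and `suc c` the path runs down the rows of length
  -- `suc c`, which are the `r` with `λ′ (suc c) ≤ r < λ′ c`. For a number `x` strictly between, the
  -- witness `r` solves `x + suc r ≡ suc c + λ′ 0`.
  horizontal⊎vertical : ∀ x → Horizontal x ⊎ Vertical x
  horizontal⊎vertical x with c , ≤x , x< ← column-locate x | m≤n⇒m<n∨m≡n ≤x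
  ... | inj₂ refl = inj₁ (c , column-horizontal c)
  ... | inj₁ <x   = inj₂ (r , ≤-trans r<λ′c (conjugate≤conjugate₀ c) , (begin
    x + suc r         ≡⟨ +-suc x r ⟩
    suc (x + r)       ≡⟨ cong suc x+r≡ ⟩
    suc c + λ′ 0      ≡⟨ cong (_+ λ′ 0) pr≡1+c ⟨
    parts p r + λ′ 0  ∎))
    where
    open ≡-Reasoning
    r = c + λ′ 0 ∸ x
    x<c+λ′0 : x < suc c + λ′ 0
    x<c+λ′0 = <-≤-trans x< (m∸n≤m _ (λ′ (suc c)))
    x+r≡ : x + r ≡ c + λ′ 0
    x+r≡ = m+[n∸m]≡n (s≤s⁻¹ x<c+λ′0)
    r<λ′c : r < λ′ c
    r<λ′c = +-cancelˡ-< x r (λ′ c)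
      (subst (_< x + λ′ c) (trans (column-horizontal c) (sym x+r≡)) (+-monoˡ-< (λ′ c) <x))
    λ′1+c≤r : λ′ (suc c) ≤ r
    λ′1+c≤r = +-cancelˡ-≤ x _ _ (s≤s⁻¹ (subst (x + λ′ (suc c) <_)
      (trans (column-horizontal (suc c)) (cong suc (sym x+r≡))) (+-monoˡ-< _ x<)))
    pr≡1+c : parts p r ≡ suc c
    pr≡1+c = ≤-antisym (≮⇒≥ λ 1+c<pr → ≤⇒≯ λ′1+c≤r (<-conjugate⇐ 1+c<pr)) (<-conjugate⇒ r<λ′c)

  -- Inside the diagram the sum is at least `suc r + suc c`, outside it is at most `r + c`. The
  -- skipped value would be a hook of length 0, that is, one number that is both horizontal and
  -- vertical.
  parts+conjugate≢ : ∀ r c → parts p r + λ′ c ≢ suc (r + c)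
  parts+conjugate≢ r c eq with c <? parts p r
  ... | yes c<pr = <-irrefl (sym (trans eq (cong suc (+-comm r c))))
    (<-≤-trans (s≤s (≤-reflexive (sym (+-suc c r)))) (+-mono-≤ c<pr (<-conjugate⇐ c<pr)))
  ... | no  c≮pr = <-irrefl eq (s≤s (≤-trans
    (+-mono-≤ (≮⇒≥ c≮pr) (≮⇒≥ (c≮pr ∘ <-conjugate⇒))) (≤-reflexive (+-comm c r))))

  private
    -- Here `l`, `l′` and `g` stand for `parts p r`, `λ′ c` and `λ′ 0`. Eliminating `x` and `g` from
    -- the positions of a horizontal step `x` in column `c` and a vertical step `x + s` in row `r`
    -- leaves the equation for hook length `s` at `(r , c)`.
    rearrange : ∀ {x s r c l l′ g} →
      x + l′ ≡ c + g → x + s + suc r ≡ l + g → l + l′ ≡ suc (r + c + s)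
    rearrange {x} {s} {r} {c} {l} {l′} {g} h v = +-cancelʳ-≡ (x + g) _ _ (begin
      l + l′ + (x + g)          ≡⟨ shuffle₁ l l′ x g ⟩
      x + l′ + (l + g)          ≡⟨ cong₂ _+_ h (sym v) ⟩
      c + g + (x + s + suc r)   ≡⟨ shuffle₂ c g x s r ⟩
      suc (r + c + s) + (x + g) ∎)
      where
      open ≡-Reasoning
      shuffle₁ : ∀ l l′ x g → l + l′ + (x + g) ≡ x + l′ + (l + g)
      shuffle₁ = solve-∀
      shuffle₂ : ∀ c g x s r → c + g + (x + s + suc r) ≡ suc (r + c + s) + (x + g)
      shuffle₂ = solve-∀

    unrearrange : ∀ {x s r c l l′ g} →
      x + l′ ≡ c + g → l + l′ ≡ suc (r + c + s) → x + s + suc r ≡ l + g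
    unrearrange {x} {s} {r} {c} {l} {l′} {g} h e = +-cancelʳ-≡ (c + l′) _ _ (begin
      x + s + suc r + (c + l′)   ≡⟨ shuffle₁ x s r c l′ ⟩
      x + l′ + suc (r + c + s)   ≡⟨ cong₂ _+_ h (sym e) ⟩
      c + g + (l + l′)           ≡⟨ shuffle₂ c g l l′ ⟩
      l + g + (c + l′) ∎)
      where
      open ≡-Reasoning
      shuffle₁ : ∀ x s r c l′ → x + s + suc r + (c + l′) ≡ x + l′ + suc (r + c + s)
      shuffle₁ = solve-∀
      shuffle₂ : ∀ c g l l′ → c + g + (l + l′) ≡ l + g + (c + l′)
      shuffle₂ = solve-∀

  ¬horizontal×vertical : ∀ {x} → Horizontal x → ¬ Vertical x
  ¬horizontal×vertical {x} (c , h) (r , _ , v) = parts+conjugate≢ r c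
    (trans (rearrange {x} {0} h (trans (cong (_+ suc r) (+-identityʳ x)) v))
           (cong suc (+-identityʳ (r + c))))

  horizontal₀ : Horizontal 0
  horizontal₀ = 0 , refl

  private
    hookLength-ℤ : ∀ r c → hookLength p (r , c) ≡ (+ (parts p r + λ′ c)) ℤ.- + suc (r + c)
    hookLength-ℤ r c = begin
      + 1 ℤ.+ (parts p r ⊖ suc r) ℤ.+ (λ′ c ⊖ suc c)
        ≡⟨ cong₂ (λ a b → + 1 ℤ.+ a ℤ.+ b)
             (sym (ℤ.m-n≡m⊖n (parts p r) (suc r))) (sym (ℤ.m-n≡m⊖n (λ′ c) (suc c))) ⟩
      + 1 ℤ.+ (+ parts p r ℤ.- (+ 1 ℤ.+ + r)) ℤ.+ (+ λ′ c ℤ.- (+ 1 ℤ.+ + c))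
        ≡⟨ shuffle (+ parts p r) (+ r) (+ λ′ c) (+ c) ⟩
      (+ parts p r ℤ.+ + λ′ c) ℤ.- (+ 1 ℤ.+ (+ r ℤ.+ + c))
        ∎
      where
      open ≡-Reasoning
      shuffle : ∀ l r l′ c → + 1 ℤ.+ (l ℤ.- (+ 1 ℤ.+ r)) ℤ.+ (l′ ℤ.- (+ 1 ℤ.+ c))
                           ≡ (l ℤ.+ l′) ℤ.- (+ 1 ℤ.+ (r ℤ.+ c))
      shuffle = ℤ-Solver.solve-∀

  hookLength≡⇒ : ∀ r c s → hookLength p (r , c) ≡ + s → parts p r + λ′ c ≡ suc (r + c + s)
  hookLength≡⇒ r c s eq = ℤ.+-injective (begin
    + (parts p r + λ′ c)
      ≡⟨ shuffle (+ (parts p r + λ′ c)) (+ suc (r + c)) ⟩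
    + (parts p r + λ′ c) ℤ.- + suc (r + c) ℤ.+ + suc (r + c)
      ≡⟨ cong (ℤ._+ + suc (r + c)) (trans (sym (hookLength-ℤ r c)) eq) ⟩
    + (s + suc (r + c))
      ≡⟨ cong +_ (+-comm s _) ⟩
    + suc (r + c + s)
      ∎)
    where
    open ≡-Reasoning
    shuffle : ∀ a b → a ≡ a ℤ.- b ℤ.+ b
    shuffle = ℤ-Solver.solve-∀

  hookLength≡⇐ : ∀ r c s → parts p r + λ′ c ≡ suc (r + c + s) → hookLength p (r , c) ≡ + s
  hookLength≡⇐ r c s eq = begin
    hookLength p (r , c)                           ≡⟨ hookLength-ℤ r c ⟩
    + (parts p r + λ′ c) ℤ.- + suc (r + c)         ≡⟨ cong (λ z → + z ℤ.- + suc (r + c)) eq ⟩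
    + suc (r + c) ℤ.+ + s ℤ.- + suc (r + c)        ≡⟨ shuffle (+ suc (r + c)) (+ s) ⟩
    + s                                            ∎
    where
    open ≡-Reasoning
    shuffle : ∀ a b → a ℤ.+ b ℤ.- a ≡ b
    shuffle = ℤ-Solver.solve-∀

  core⇒closed : ∀ {s} → IsCore s p → ∀ {x} → Horizontal x → Horizontal (x + s)
  core⇒closed {s} core {x} (c , h) with horizontal⊎vertical (x + s)
  ... | inj₁ h′          = h′
  ... | inj₂ (r , r< , v) = contradiction (hookLength≡⇐ r c s hook) (core (r , c) c<pr)
    where
    hook : parts p r + λ′ c ≡ suc (r + c + s)
    hook = rearrange h v
    -- Outside the diagram `parts p r ≤ c` and `λ′ c ≤ r`, so the sum in `hook` could not exceed
    -- `r + c`.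
    c<pr : c < parts p r
    c<pr = ≰⇒> λ pr≤c → <-irrefl hook (s≤s (≤-trans
      (≤-trans (+-mono-≤ pr≤c (≮⇒≥ (λ r< → ≤⇒≯ pr≤c (<-conjugate⇒ r<)))) (≤-reflexive (+-comm c r)))
      (m≤m+n (r + c) s)))

  closed⇒core : ∀ {s} → (∀ {x} → Horizontal x → Horizontal (x + s)) → IsCore s p
  closed⇒core {s} closed (r , c) c<pr eq =
    ¬horizontal×vertical (closed (c , column-horizontal c))
      (r , <-conjugate⇐ (≤-<-trans z≤n c<pr) ,
       unrearrange (column-horizontal c) (hookLength≡⇒ r c s eq))

-- Partitions are determined by their horizontal steps

≤-strictlyMonotone : ∀ {τ : ℕ → ℕ} → (∀ {a b} → a < b → τ a < τ b) → ∀ c → c ≤ τ c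
≤-strictlyMonotone mono zero    = z≤n
≤-strictlyMonotone mono (suc c) = ≤-<-trans (≤-strictlyMonotone mono c) (mono (n<1+n c))

-- `column` lists the horizontal steps in increasing order, and passing to a subset can only move
-- the `c`-th entry up: `τ c` is the place among the steps of `p` of the `c`-th step of `q`, and a
-- strictly increasing `τ` satisfies `c ≤ τ c`.
column-≤ : ∀ p q → (∀ {x} → Horizontal q x → Horizontal p x) → ∀ c → column p c ≤ column q c
column-≤ p q q⊆p c = begin
  column p c      ≤⟨ mono⇒≤ (column-mono-< p) (≤-strictlyMonotone τ-mono c) ⟩
  column p (τ c)  ≡⟨ column-τ c ⟩
  column q c      ∎
  where
  open ≤-Reasoning
  τ : ℕ → ℕ
  τ c = proj₁ (q⊆p (c , column-horizontal q c))
  column-τ : ∀ c → column p (τ c) ≡ column q c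
  column-τ c = +-cancelʳ-≡ _ _ _ (trans (column-horizontal p (τ c))
                 (sym (proj₂ (q⊆p (c , column-horizontal q c)))))
  mono⇒≤ : ∀ {f : ℕ → ℕ} → (∀ {a b} → a < b → f a < f b) → ∀ {a b} → a ≤ b → f a ≤ f b
  mono⇒≤ mono a≤b with m≤n⇒m<n∨m≡n a≤b
  ... | inj₁ a<b  = <⇒≤ (mono a<b)
  ... | inj₂ refl = ≤-refl
  τ-mono : ∀ {a b} → a < b → τ a < τ b
  τ-mono {a} {b} a<b = ≰⇒> λ τb≤τa → <⇒≱ (column-mono-< q a<b)
    (subst₂ _≤_ (column-τ b) (column-τ a) (mono⇒≤ (column-mono-< p) τb≤τa))

parts-determined : ∀ p q → (∀ {x} → Horizontal p x → Horizontal q x) →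
  (∀ {x} → Horizontal q x → Horizontal p x) → ∀ r → parts p r ≡ parts q r
parts-determined p q p⊆q q⊆p r = ≡-by-<
  (λ c c< → <-conjugate⇒ q (subst (r <_) (conjugate≡ c) (<-conjugate⇐ p c<)))
  (λ c c< → <-conjugate⇒ p (subst (r <_) (sym (conjugate≡ c)) (<-conjugate⇐ q c<)))
  where
  open ≡-Reasoning
  column≡ : ∀ c → column p c ≡ column q c
  column≡ c = ≤-antisym (column-≤ p q q⊆p c) (column-≤ q p p⊆q c)
  -- The numbers `column p c` involve the unknown `conjugate p 0`. To the right of both diagrams the
  -- conjugates vanish, so the column there reveals it.
  far : ℕ
  far = parts p 0 + parts q 0
  column-far : ∀ p → parts p 0 ≤ far → column p far ≡ far + conjugate p 0
  column-far p ≤far = cong (far + conjugate p 0 ∸_) (conjugate-vanishes p ≤far)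
  conjugate₀≡ : conjugate p 0 ≡ conjugate q 0
  conjugate₀≡ = +-cancelˡ-≡ far _ _ (begin
    far + conjugate p 0  ≡⟨ column-far p (m≤m+n _ _) ⟨
    column p far         ≡⟨ column≡ far ⟩
    column q far         ≡⟨ column-far q (m≤n+m _ _) ⟩
    far + conjugate q 0  ∎)
  conjugate≡ : ∀ c → conjugate p c ≡ conjugate q c
  conjugate≡ c = +-cancelˡ-≡ (column p c) _ _ (begin
    column p c + conjugate p c  ≡⟨ column-horizontal p c ⟩
    c + conjugate p 0           ≡⟨ cong (λ z → c + z) conjugate₀≡ ⟩
    c + conjugate q 0           ≡⟨ column-horizontal q c ⟨
    column q c + conjugate q c  ≡⟨ cong (_+ conjugate q c) (column≡ c) ⟨
    column p c + conjugate q c  ∎)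

horizontal? : ∀ p → Decidable (Horizontal p)
horizontal? p x with horizontal⊎vertical p x
... | inj₁ h = yes h
... | inj₂ v = no λ h → ¬horizontal×vertical p h v

-- The conjugate is computed with `bound`, which equality of partitions ignores; its
-- characterisation by `c < parts p r` shows that the bound does not affect its value.
horizontal-cong : ∀ {p q} → (∀ r → parts p r ≡ parts q r) → ∀ {x} → Horizontal p x → Horizontal q x
horizontal-cong {p} {q} p≈q {x} (c , eq) = c ,
  subst₂ (λ y z → x + y ≡ c + z) (conjugate-cong c) (conjugate-cong 0) eq
  where
  conjugate-cong : ∀ c → conjugate p c ≡ conjugate q c
  conjugate-cong c = ≡-by-<
    (λ r r< → <-conjugate⇐ q (subst (c <_) (p≈q r) (<-conjugate⇒ p r<)))
    (λ r r< → <-conjugate⇐ p (subst (c <_) (sym (p≈q r)) (<-conjugate⇒ q r<)))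

sum≤* : ∀ (f : ℕ → ℕ) c k → (∀ r → f r ≤ c) → (∀ r → k ≤ r → f r ≡ 0) →
  ∀ n → sum (applyUpTo f n) ≤ k * c
sum≤* f c k       f≤c f≡0 zero    = z≤n
sum≤* f c zero    f≤c f≡0 (suc n) = +-mono-≤ (≤-reflexive (f≡0 0 z≤n))
  (sum≤* (f ∘ suc) c 0 (f≤c ∘ suc) (λ r _ → f≡0 (suc r) z≤n) n)
sum≤* f c (suc k) f≤c f≡0 (suc n) = +-mono-≤ (f≤c 0)
  (sum≤* (f ∘ suc) c k (f≤c ∘ suc) (λ r k≤r → f≡0 (suc r) (s≤s k≤r)) n)

-- The partition whose boundary path has a horizontal step at each number in S
-- and a vertical step at each other number below K.
module FromSteps {S : Pred ℕ 0ℓ} (S? : Decidable S) where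

  members gaps : ℕ → ℕ
  members zero = 0
  members (suc K) with S? K
  ... | yes _ = suc (members K)
  ... | no  _ = members K
  gaps zero = 0
  gaps (suc K) with S? K
  ... | yes _ = gaps K
  ... | no  _ = suc (gaps K)

  -- A gap is a vertical step, and its row is as long as the number of members below it. Row 0
  -- belongs to the last gap below `K`, so each further gap puts a new row in front.
  rows : ℕ → ℕ → ℕ
  rows zero r = 0
  rows (suc K) r with S? K
  rows (suc K) r       | yes _ = rows K r
  rows (suc K) zero    | no  _ = members K
  rows (suc K) (suc r) | no  _ = rows K r

  members+gaps : ∀ K → members K + gaps K ≡ K
  members+gaps zero = refl
  members+gaps (suc K) with S? K
  ... | yes _ = cong suc (members+gaps K)
  ... | no  _ = trans (+-suc _ _) (cong suc (members+gaps K))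

  rows≤members : ∀ K r → rows K r ≤ members K
  rows≤members zero r = z≤n
  rows≤members (suc K) r with S? K
  rows≤members (suc K) r       | yes _ = m≤n⇒m≤1+n (rows≤members K r)
  rows≤members (suc K) zero    | no  _ = ≤-refl
  rows≤members (suc K) (suc r) | no  _ = rows≤members K r

  rows-decreasing : ∀ K r → rows K (suc r) ≤ rows K r
  rows-decreasing zero r = z≤n
  rows-decreasing (suc K) r with S? K
  rows-decreasing (suc K) r       | yes _ = rows-decreasing K r
  rows-decreasing (suc K) zero    | no  _ = rows≤members K 0
  rows-decreasing (suc K) (suc r) | no  _ = rows-decreasing K r

  rows-vanish : ∀ K r → gaps K ≤ r → rows K r ≡ 0
  rows-vanish zero r _ = refl
  rows-vanish (suc K) r ≤r with S? K
  rows-vanish (suc K) r       ≤r       | yes _ = rows-vanish K r ≤r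
  rows-vanish (suc K) (suc r) (s≤s ≤r) | no  _ = rows-vanish K r ≤r

  -- As 0 is a member, every gap has a member below it. With no empty rows, the number of gaps
  -- equals `conjugate partition 0`, the offset in the numbering of the path.
  rows-positive : S 0 → ∀ K r → r < gaps K → 0 < rows K r
  rows-positive s₀ (suc K) r r< with S? K
  rows-positive s₀ (suc K)       r       r<       | yes _  = rows-positive s₀ K r r<
  rows-positive s₀ (suc zero)    zero    r<       | no ¬s₀ = contradiction s₀ ¬s₀
  rows-positive s₀ (suc (suc K)) zero    r<       | no _   = members-positive K
    where
    members-positive : ∀ K → 0 < members (suc K)
    members-positive K with S? K
    members-positive K       | yes _ = z<s
    members-positive zero    | no ¬s₀ = contradiction s₀ ¬s₀
    members-positive (suc K) | no _ = members-positive K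
  rows-positive s₀ (suc K)       (suc r) (s<s r<) | no _   = rows-positive s₀ K r r<

  -- Below the gap of row `r` lie `rows K r` members and `gaps K ∸ suc r` gaps. This is the equation
  -- of `Vertical`, with `gaps K` for the height of the first column.
  gap⇒row : ∀ K x → x < K → ¬ S x → ∃[ r ] r < gaps K × x + suc r ≡ rows K r + gaps K
  gap⇒row (suc K) x x<1+K ¬s with S? K | m≤n⇒m<n∨m≡n (s≤s⁻¹ x<1+K)
  ... | yes s | inj₂ refl = contradiction s ¬s
  ... | yes _ | inj₁ x<K  = gap⇒row K x x<K ¬s
  ... | no _  | inj₂ refl = 0 , z<s ,
    trans (+-comm x 1) (trans (cong suc (sym (members+gaps x))) (sym (+-suc _ _)))
  ... | no _  | inj₁ x<K  with r , r< , eq ← gap⇒row K x x<K ¬s =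
    suc r , s<s r< , trans (+-suc x (suc r)) (trans (cong suc eq) (sym (+-suc _ _)))

  row⇒gap : ∀ K r → r < gaps K → ∃[ x ] ¬ S x × x + suc r ≡ rows K r + gaps K
  row⇒gap (suc K) r r< with S? K
  row⇒gap (suc K) r       r<       | yes _ = row⇒gap K r r<
  row⇒gap (suc K) zero    r<       | no ¬s = K , ¬s ,
    trans (+-comm K 1) (trans (cong suc (sym (members+gaps K))) (sym (+-suc _ _)))
  row⇒gap (suc K) (suc r) (s<s r<) | no _ with x , ¬s , eq ← row⇒gap K r r< =
    x , ¬s , trans (+-suc x (suc r)) (trans (cong suc eq) (sym (+-suc _ _)))

  module _ (s₀ : S 0) (K : ℕ) (cofinite : ∀ {x} → K ≤ x → S x) where

    partition : Partition
    partition = record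
      { parts      = rows K
      ; decreasing = rows-decreasing K
      ; bound      = gaps K * members K
      ; finiteSum  = sum≤* (rows K) (members K) (gaps K) (rows≤members K) (rows-vanish K)
      }

    conjugate₀≡gaps : conjugate partition 0 ≡ gaps K
    conjugate₀≡gaps = ≡-by-<
      (λ r r< → ≰⇒> λ gaps≤r →
        <-irrefl (sym (rows-vanish K r gaps≤r)) (<-conjugate⇒ partition r<))
      (λ r r< → <-conjugate⇐ partition (rows-positive s₀ K r r<))

    partition-horizontal⇐ : ∀ {x} → S x → Horizontal partition x
    partition-horizontal⇐ {x} s with horizontal⊎vertical partition x
    ... | inj₁ h = h
    ... | inj₂ (r , r< , eq) with x′ , ¬s , eq′ ← row⇒gap K r (subst (r <_) conjugate₀≡gaps r<) =
      contradiction (subst S (+-cancelʳ-≡ (suc r) x x′ (begin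
        x + suc r                        ≡⟨ eq ⟩
        rows K r + conjugate partition 0 ≡⟨ cong (λ z → rows K r + z) conjugate₀≡gaps ⟩
        rows K r + gaps K                ≡⟨ eq′ ⟨
        x′ + suc r                       ∎)) s) ¬s
      where open ≡-Reasoning

    partition-horizontal⇒ : ∀ {x} → Horizontal partition x → S x
    partition-horizontal⇒ {x} h with S? x
    ... | yes s = s
    ... | no ¬s with r , r< , eq ← gap⇒row K x (≰⇒> λ K≤x → ¬s (cofinite K≤x)) ¬s =
      contradiction (r , subst (r <_) (sym conjugate₀≡gaps) r< ,
                     trans eq (cong (λ z → rows K r + z) (sym conjugate₀≡gaps)))
                    (¬horizontal×vertical partition h)

-- Walks

open ≡-Reasoning

-- Arithmetic modulo `n`

module _ (n : ℕ) .{{_ : NonZero n}} where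

  %-congˡ-+ : ∀ {a b} c → a % n ≡ b % n → (a + c) % n ≡ (b + c) % n
  %-congˡ-+ {a} {b} c a≡b = begin
    (a + c) % n          ≡⟨ %-distribˡ-+ a c n ⟩
    (a % n + c % n) % n  ≡⟨ cong (λ z → (z + c % n) % n) a≡b ⟩
    (b % n + c % n) % n  ≡⟨ %-distribˡ-+ b c n ⟨
    (b + c) % n          ∎

  %-idemˡ-* : ∀ a c → (a % n * c) % n ≡ (a * c) % n
  %-idemˡ-* a c = begin
    (a % n * c) % n            ≡⟨ %-distribˡ-* (a % n) c n ⟩
    (a % n % n * (c % n)) % n  ≡⟨ cong (λ z → (z * (c % n)) % n) (m%n%n≡m%n a n) ⟩
    (a % n * (c % n)) % n      ≡⟨ %-distribˡ-* a c n ⟨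
    (a * c) % n                ∎

  %-≡∧≤⇒ : ∀ {a b} → b ≤ a → a % n ≡ b % n → ∃[ t ] a ≡ b + t * n
  %-≡∧≤⇒ {a} {b} b≤a a≡b with t , b/n+t≡a/n ← m≤n⇒∃[o]m+o≡n (/-monoˡ-≤ n b≤a) = t , (begin
    a                             ≡⟨ m≡m%n+[m/n]*n a n ⟩
    a % n + a ℕ./ n * n             ≡⟨ cong₂ (λ y z → y + z * n) a≡b (sym b/n+t≡a/n) ⟩
    b % n + (b ℕ./ n + t) * n       ≡⟨ shuffle (b % n) (b ℕ./ n) t n ⟩
    b % n + b ℕ./ n * n + t * n     ≡⟨ cong (_+ t * n) (m≡m%n+[m/n]*n b n) ⟨
    b + t * n                     ∎)
    where
    shuffle : ∀ x q t n → x + (q + t) * n ≡ x + q * n + t * n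
    shuffle = solve-∀

  %-step : ∀ {a b} i j → b + i * n ≡ a + j * n → b % n ≡ a % n
  %-step {a} {b} i j eq = trans (sym ([m+kn]%n≡m%n b i n)) (trans (cong (_% n) eq) ([m+kn]%n≡m%n a j n))

private
  coprime-multiple : ∀ {c} n .{{_ : NonZero n}} → Coprime c n → ∀ x → ∃[ k ] x % n ≡ (k * c) % n
  coprime-multiple {c} (suc n) cop x with coprime-Bézout cop
  ... | Bézout.+- a b eq = x * a , %-step (suc n) (x * b) 0 (begin
      x + x * b * suc n      ≡⟨ shuffle₁ x b n ⟩
      x * (1 + b * suc n)    ≡⟨ cong (x *_) eq ⟩
      x * (a * c)            ≡⟨ shuffle₂ x a c n ⟩
      x * a * c + 0          ∎)
    where
    shuffle₁ : ∀ x b n → x + x * b * suc n ≡ x * (1 + b * suc n)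
    shuffle₁ = solve-∀
    shuffle₂ : ∀ x a c n → x * (a * c) ≡ x * a * c + 0
    shuffle₂ = solve-∀
  -- Now `1 + a * c` is a multiple of the modulus `suc n`, so `c` has inverse `- a`; the factor `n`,
  -- which is -1 modulo `suc n`, replaces the sign.
  ... | Bézout.-+ a b eq = x * a * n , %-step (suc n) (x * (a * c)) (x * b) (begin
      x + x * (a * c) * suc n          ≡⟨ shuffle₁ x a c n ⟩
      x * a * n * c + x * (1 + a * c)  ≡⟨ cong (λ z → x * a * n * c + x * z) eq ⟩
      x * a * n * c + x * (b * suc n)  ≡⟨ cong (λ z → x * a * n * c + z) (*-assoc x b (suc n)) ⟨
      x * a * n * c + x * b * suc n    ∎)
    where
    shuffle₁ : ∀ x a c n → x + x * (a * c) * suc n ≡ x * a * n * c + x * (1 + a * c)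
    shuffle₁ = solve-∀

coprime-residue : ∀ {c n} .{{_ : NonZero n}} → Coprime c n →
  ∀ x → ∃[ k ] k < n × x % n ≡ (k * c) % n
coprime-residue {c} {n} cop x with k , eq ← coprime-multiple n cop x =
  k % n , m%n<n k n , trans eq (sym (%-idemˡ-* n k c))

coprime-cancel : ∀ {c n k t} → Coprime c n → k < n → k * c ≡ t * n → k ≡ 0
coprime-cancel {k = zero}  _   _   _  = refl
coprime-cancel {c} {n} {suc k} {t} cop k<n eq = contradiction k<n
  (≤⇒≯ (∣⇒≤ (coprime-divisor (Coprime.sym cop) (divides t (trans (*-comm c (suc k)) eq)))))

-- Words of steps and their rotations

data Step : Set where
  up level down : Step

ups₁ downs₁ : Step → ℕ
ups₁ up    = 1
ups₁ level = 0
ups₁ down  = 0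
downs₁ up    = 0
downs₁ level = 0
downs₁ down  = 1

ups downs : List Step → ℕ
ups   = sum ∘ map ups₁
downs = sum ∘ map downs₁

ups₁≤1 : ∀ s → ups₁ s ≤ 1
ups₁≤1 up    = ≤-refl
ups₁≤1 level = z≤n
ups₁≤1 down  = z≤n

downs₁≤1 : ∀ s → downs₁ s ≤ 1
downs₁≤1 up    = z≤n
downs₁≤1 level = z≤n
downs₁≤1 down  = ≤-refl

step-determined : ∀ s s′ → downs₁ s + ups₁ s′ ≡ downs₁ s′ + ups₁ s → s ≡ s′
step-determined up    up    _ = refl
step-determined level level _ = refl
step-determined down  down  _ = refl

module Walks (m d n : ℕ) .{{_ : NonZero n}} (m+d≡n : m + d ≡ n)
             (coprime-d : Coprime d n) (coprime-m : Coprime m n) where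

  -- The steps change the height by d + n, d and d - n = -m; heights never go below 0.
  Edge : ℕ → Step → ℕ → Set
  Edge a s b = b + downs₁ s * n ≡ a + d + ups₁ s * n

  data Walk : ℕ → List Step → ℕ → Set where
    []  : ∀ {a} → Walk a [] a
    _∷_ : ∀ {a s b w c} → Edge a s b → Walk b w c → Walk a (s ∷ w) c

  edge-target : ∀ {a s b b′} → Edge a s b → Edge a s b′ → b ≡ b′
  edge-target {s = s} {b} {b′} e e′ = +-cancelʳ-≡ (downs₁ s * n) b b′ (trans e (sym e′))

  edge-step : ∀ {a s s′ b} → Edge a s b → Edge a s′ b → s ≡ s′
  edge-step {a} {s} {s′} {b} e e′ = step-determined s s′ (*-cancelʳ-≡ _ _ n
    (+-cancelˡ-≡ (a + d + b) _ _ (begin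
      a + d + b + (downs₁ s + ups₁ s′) * n
        ≡⟨ shuffle (a + d) b (downs₁ s) (ups₁ s′) n ⟩
      b + downs₁ s * n + (a + d + ups₁ s′ * n)
        ≡⟨ cong₂ _+_ e (sym e′) ⟩
      a + d + ups₁ s * n + (b + downs₁ s′ * n)
        ≡⟨ +-comm (a + d + ups₁ s * n) (b + downs₁ s′ * n) ⟩
      b + downs₁ s′ * n + (a + d + ups₁ s * n)
        ≡⟨ shuffle (a + d) b (downs₁ s′) (ups₁ s) n ⟨
      a + d + b + (downs₁ s′ + ups₁ s) * n
        ∎)))
    where
    shuffle : ∀ h b i j n → h + b + (i + j) * n ≡ b + i * n + (h + j * n)
    shuffle = solve-∀

  edge-shift : ∀ {a s b} t → Edge a s b → Edge (a + t) s (b + t)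
  edge-shift {a} {s} {b} t e = begin
    b + t + downs₁ s * n      ≡⟨ shuffle b t _ ⟩
    b + downs₁ s * n + t      ≡⟨ cong (_+ t) e ⟩
    a + d + ups₁ s * n + t    ≡⟨ shuffle₂ a d _ t ⟩
    a + t + d + ups₁ s * n    ∎
    where
    shuffle : ∀ b t z → b + t + z ≡ b + z + t
    shuffle = solve-∀
    shuffle₂ : ∀ a d z t → a + d + z + t ≡ a + t + d + z
    shuffle₂ = solve-∀

  walk-shift : ∀ {a w c} t → Walk a w c → Walk (a + t) w (c + t)
  walk-shift t []                = []
  walk-shift t (_∷_ {s = s} e p) = edge-shift {s = s} t e ∷ walk-shift t p

  _++ʷ_ : ∀ {a u b v c} → Walk a u b → Walk b v c → Walk a (u ++ v) c
  []      ++ʷ q = q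
  (e ∷ p) ++ʷ q = e ∷ (p ++ʷ q)

  walk-split : ∀ {a} u {v c} → Walk a (u ++ v) c → ∃[ b ] Walk a u b × Walk b v c
  walk-split []      p       = _ , [] , p
  walk-split (s ∷ u) (e ∷ p) with b , p₁ , p₂ ← walk-split u p = b , e ∷ p₁ , p₂

  walk-height : ∀ {a w c} → Walk a w c → c + downs w * n ≡ a + length w * d + ups w * n
  walk-height {a} [] = cong (_+ 0) (sym (+-identityʳ a))
  walk-height {a} {s ∷ w} {c} (_∷_ {b = b} e p) = +-cancelˡ-≡ b _ _ (begin
    b + (c + (downs₁ s + downs w) * n)
      ≡⟨ shuffle₁ b c (downs₁ s) (downs w) n ⟩
    b + downs₁ s * n + (c + downs w * n)
      ≡⟨ cong₂ _+_ e (walk-height p) ⟩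
    a + d + ups₁ s * n + (b + length w * d + ups w * n)
      ≡⟨ shuffle₂ a d (ups₁ s) n b (length w) (ups w) ⟩
    b + (a + suc (length w) * d + (ups₁ s + ups w) * n)
      ∎)
    where
    shuffle₁ : ∀ b c x y n → b + (c + (x + y) * n) ≡ b + x * n + (c + y * n)
    shuffle₁ = solve-∀
    shuffle₂ : ∀ a d x n b l y →
      a + d + x * n + (b + l * d + y * n) ≡ b + (a + suc l * d + (x + y) * n)
    shuffle₂ = solve-∀

  edge-residue : ∀ {a b} s → Edge a s b → b % n ≡ (a + d) % n
  edge-residue s = %-step n (downs₁ s) (ups₁ s)

  walk? : ∀ a w c → Dec (Walk a w c)
  walk? a []      c = map′ (λ { refl → [] }) (λ { [] → refl }) (a ≟ c)
  walk? a (s ∷ w) c with downs₁ s * n ≤? a + d + ups₁ s * n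
  ... | no  ≰  = no λ { (_∷_ {b = b} e p) → ≰ (≤-trans (m≤n+m _ b) (≤-reflexive e)) }
  ... | yes ≤a = map′ (λ p → m∸n+n≡m ≤a ∷ p)
    (λ { (e ∷ p) → subst (λ b → Walk b w c) (edge-target {s = s} e (m∸n+n≡m ≤a)) p })
    (walk? _ w c)

  Balanced : List Step → Set
  Balanced w = length w ≡ n × downs w ≡ d + ups w

  closed⇒balanced : ∀ {w} → length w ≡ n → Walk 0 w 0 → Balanced w
  closed⇒balanced {w} len p = len , *-cancelʳ-≡ _ _ n (begin
    downs w * n                   ≡⟨ walk-height p ⟩
    length w * d + ups w * n      ≡⟨ cong (λ z → z * d + ups w * n) len ⟩
    n * d + ups w * n             ≡⟨ cong (_+ ups w * n) (*-comm n d) ⟩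
    d * n + ups w * n             ≡⟨ *-distribʳ-+ n d (ups w) ⟨
    (d + ups w) * n               ∎)

  balanced⇒closed : ∀ {a w c} → Balanced w → Walk a w c → c ≡ a
  balanced⇒closed {a} {w} {c} (len , bal) p = +-cancelʳ-≡ (downs w * n) c a (begin
    c + downs w * n                   ≡⟨ walk-height p ⟩
    a + length w * d + ups w * n      ≡⟨ cong (λ z → a + z * d + ups w * n) len ⟩
    a + n * d + ups w * n             ≡⟨ shuffle a n d (ups w) ⟩
    a + (d + ups w) * n               ≡⟨ cong (λ z → a + z * n) bal ⟨
    a + downs w * n                   ∎)
    where
    shuffle : ∀ a n d u → a + n * d + u * n ≡ a + (d + u) * n
    shuffle = solve-∀

  -- The heights are normalised so that the lowest, at the cut, is 0. A step `s` put in front must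
  -- start at `a′` with `a′ + d + ups₁ s * n ≡ a + downs₁ s * n`. If no natural `a′` does, the new
  -- start is the minimum, and the rest is lifted by the deficit `t`.
  cut-at-minimum : ∀ w → ∃[ u ] ∃[ v ] w ≡ u ++ v × ∃[ a ] ∃[ e ] Walk a u 0 × Walk 0 v e
  cut-at-minimum [] = [] , [] , refl , 0 , 0 , [] , []
  cut-at-minimum (s ∷ w) with u , v , refl , a , e , p , q ← cut-at-minimum w
    | ≤-total (d + ups₁ s * n) (a + downs₁ s * n)
  ... | inj₁ ≤a with a′ , eq ← m≤n⇒∃[o]m+o≡n ≤a =
    s ∷ u , v , refl , a′ , e , edge ∷ p , q
    where
    edge : Edge a′ s a
    edge = trans (sym eq) (trans (+-comm _ a′) (sym (+-assoc a′ d _)))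
  ... | inj₂ a≤ with t , eq ← m≤n⇒∃[o]m+o≡n a≤ =
    [] , s ∷ u ++ v , refl , 0 , e + t , [] , edge ∷ (walk-shift t p ++ʷ walk-shift t q)
    where
    edge : Edge 0 s (a + t)
    edge = trans (shuffle a t (downs₁ s * n)) eq
      where
      shuffle : ∀ a t x → a + t + x ≡ a + x + t
      shuffle = solve-∀

  -- A balanced word ends at its starting height, so the part before the cut can be walked after the
  -- part behind it.
  closed-rotation : ∀ w → Balanced w → ∃[ u ] ∃[ v ] w ≡ u ++ v × Walk 0 (v ++ u) 0
  closed-rotation w bal with u , v , refl , a , e , p , q ← cut-at-minimum w =
    u , v , refl , q ++ʷ subst (λ b → Walk b u 0) (sym (balanced⇒closed bal (p ++ʷ q))) p

  -- The word `u` leads from 0 to `h` in one walk and from `h′` to 0 in the other. Its change of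
  -- height is the same in both, so `h + h′` is 0. Hence `u` does not change the height, and `n`
  -- divides `length u * d`.
  closed-rotation-unique : ∀ u v → length u < n →
    Walk 0 (u ++ v) 0 → Walk 0 (v ++ u) 0 → u ≡ []
  closed-rotation-unique u v u<n p q
    with h , pu , _ ← walk-split u p | h′ , _ , qu ← walk-split v q = length≡0 u |u|≡0
    where
    length≡0 : ∀ u → length u ≡ 0 → u ≡ []
    length≡0 [] _ = refl
    rest : ℕ
    rest = length u * d + ups u * n
    h+h′≡0 : h + h′ ≡ 0
    h+h′≡0 = +-cancelʳ-≡ rest _ _ (begin
      h + h′ + rest                          ≡⟨ +-assoc h h′ rest ⟩
      h + (h′ + rest)                        ≡⟨ cong (λ z → h + z) (+-assoc h′ _ _) ⟨
      h + (h′ + length u * d + ups u * n)    ≡⟨ cong (λ z → h + z) (walk-height qu) ⟨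
      h + downs u * n                        ≡⟨ walk-height pu ⟩
      rest                                   ∎)
    h′≡0 : h′ ≡ 0
    h′≡0 = m+n≡0⇒n≡0 h h+h′≡0
    height : downs u * n ≡ length u * d + ups u * n
    height = trans (walk-height qu) (cong (λ z → z + length u * d + ups u * n) h′≡0)
    |u|≡0 : length u ≡ 0
    |u|≡0 = coprime-cancel {t = downs u ∸ ups u} coprime-d u<n (begin
      length u * d               ≡⟨ m+n∸n≡m (length u * d) (ups u * n) ⟨
      length u * d + ups u * n ∸ ups u * n ≡⟨ cong (_∸ ups u * n) height ⟨
      downs u * n ∸ ups u * n    ≡⟨ *-distribʳ-∸ n (downs u) (ups u) ⟨
      (downs u ∸ ups u) * n      ∎)

  -- The set covered by a walk

  vertices : ∀ {a w c} → Walk a w c → List ℕ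
  -- The endpoint is left out: in a closed walk it repeats the start, which would list one class
  -- modulo `n` twice.
  vertices []              = []
  vertices (_∷_ {a = a} e p) = a ∷ vertices p

  Above : ℕ → ℕ → Set
  Above b x = b ≤ x × x % n ≡ b % n

  -- The set `S` that a walk encodes: the union of the progressions `b`, `b + n`, `b + 2 * n`, ...
  -- over its vertices `b`.
  Covered : ∀ {a w c} → Walk a w c → ℕ → Set
  Covered p x = Any (λ b → Above b x) (vertices p)

  covered? : ∀ {a w c} (p : Walk a w c) → Decidable (Covered p)
  covered? p x = Any.any? (λ b → (b ≤? x) ×-dec (x % n ≟ b % n)) (vertices p)

  covered-irrelevant : ∀ {a w c c′} (p : Walk a w c) (q : Walk a w c′) → ∀ {x} →
    Covered p x → Covered q x
  covered-irrelevant (e ∷ p) (e′ ∷ q) (here above) = here above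
  covered-irrelevant {w = s ∷ _} (e ∷ p) (e′ ∷ q) (there cov)
    with refl ← edge-target {s = s} e e′ = there (covered-irrelevant p q cov)

  -- A step descends by at most `m`, and adding `m`, which is `- d` modulo `n`, leads back to the
  -- class of the previous vertex. In `above-next` a step rises by at most `n + d`, in the opposite
  -- direction.
  above-prev : ∀ {a b x} s → Edge a s b → Above b x → Above a (x + m)
  above-prev {a} {b} {x} s e (b≤x , x≡b) = +-cancelʳ-≤ d _ _ a+d≤ , (begin
    (x + m) % n       ≡⟨ %-congˡ-+ n m (trans x≡b (edge-residue s e)) ⟩
    (a + d + m) % n   ≡⟨ cong (_% n) (trans (+-assoc a d m) (cong (λ z → a + z) (trans (+-comm d m) m+d≡n))) ⟩
    (a + n) % n       ≡⟨ [m+n]%n≡m%n a n ⟩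
    a % n             ∎)
    where
    a+d≤ : a + d ≤ x + m + d
    a+d≤ = ≤-trans (m≤m+n (a + d) _) (≤-trans (≤-reflexive (sym e))
      (≤-trans (+-mono-≤ b≤x (*-monoˡ-≤ n (downs₁≤1 s)))
        (≤-reflexive (trans (cong (λ z → x + z) (trans (*-identityˡ n) (sym m+d≡n))) (sym (+-assoc x m d))))))

  above-next : ∀ {a b x} s → Edge a s b → Above a x → Above b (x + (n + d))
  above-next {a} {b} {x} s e (a≤x , x≡a) =
    ≤-trans (m≤m+n b _) (≤-trans (≤-reflexive e)
      (≤-trans (+-mono-≤ (+-monoˡ-≤ d a≤x) (*-monoˡ-≤ n (ups₁≤1 s)))
        (≤-reflexive (trans (cong (λ z → x + d + z) (*-identityˡ n)) shuffle)))) ,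
    (begin
      (x + (n + d)) % n   ≡⟨ cong (_% n) shuffle ⟨
      (x + d + n) % n     ≡⟨ [m+n]%n≡m%n (x + d) n ⟩
      (x + d) % n         ≡⟨ %-congˡ-+ n d x≡a ⟩
      (a + d) % n         ≡⟨ edge-residue s e ⟨
      b % n               ∎)
    where
    shuffle : x + d + n ≡ x + (n + d)
    shuffle = trans (+-assoc x d n) (cong (λ z → x + z) (+-comm d n))

  above-n : ∀ {b x} → Above b x → Above b (x + n)
  above-n {x = x} (b≤x , x≡b) = m≤n⇒m≤n+o n b≤x , trans ([m+n]%n≡m%n x n) x≡b

  private
    -- Only the first vertex lacks a predecessor. In a closed walk the start is also the endpoint,
    -- and `covered-last` then supplies the last vertex. For `covered-n+d` the roles of the two ends
    -- are exchanged.
    covered-m : ∀ {a w c} (p : Walk a w c) → ∀ {x} →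
      Covered p x → Above a x ⊎ Covered p (x + m)
    covered-m (e ∷ p) (here above) = inj₁ above
    covered-m {w = s ∷ _} (e ∷ p) (there cov) with covered-m p cov
    ... | inj₁ above = inj₂ (here (above-prev s e above))
    ... | inj₂ cov′  = inj₂ (there cov′)

    covered-last : ∀ {a s w c} (p : Walk a (s ∷ w) c) → ∀ {x} → Above c x → Covered p (x + m)
    covered-last {s = s} (e ∷ [])    above = here (above-prev s e above)
    covered-last         (e ∷ p@(_ ∷ _)) above = there (covered-last p above)

    covered-n+d : ∀ {a w c} (p : Walk a w c) → ∀ {x} →
      Covered p x → Covered p (x + (n + d)) ⊎ Above c (x + (n + d))
    covered-n+d {w = s ∷ _} (e ∷ [])    (here above) = inj₂ (above-next s e above)
    covered-n+d {w = s ∷ _} (e ∷ f ∷ p) (here above) = inj₁ (there (here (above-next s e above)))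
    covered-n+d (e ∷ p) (there cov) with covered-n+d p cov
    ... | inj₁ cov′  = inj₁ (there cov′)
    ... | inj₂ above = inj₂ above

    length≡n⇒≢[] : ¬ (length {A = Step} [] ≡ n)
    length≡n⇒≢[] = ≢-nonZero⁻¹ n ∘ sym

  module Closed {w : List Step} (|w|≡n : length w ≡ n) (p : Walk 0 w 0) where

    covered-start : ∀ {x} → Above 0 x → Covered p x
    covered-start = go p |w|≡n
      where
      go : ∀ {w} (p : Walk 0 w 0) → length w ≡ n → ∀ {x} → Above 0 x → Covered p x
      go []      len = contradiction len length≡n⇒≢[]
      go (e ∷ p) len = here

    covered₀ : Covered p 0
    covered₀ = covered-start (z≤n , refl)

    covered+m : ∀ {x} → Covered p x → Covered p (x + m)
    covered+m = go p |w|≡n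
      where
      go : ∀ {w} (p : Walk 0 w 0) → length w ≡ n → ∀ {x} → Covered p x → Covered p (x + m)
      go []        len = contradiction len length≡n⇒≢[]
      go p@(_ ∷ _) len cov with covered-m p cov
      ... | inj₁ above = covered-last p above
      ... | inj₂ cov′  = cov′

    covered+n : ∀ {x} → Covered p x → Covered p (x + n)
    covered+n = Any.map above-n

    covered+[n+d] : ∀ {x} → Covered p x → Covered p (x + (n + d))
    covered+[n+d] cov with covered-n+d p cov
    ... | inj₁ cov′  = cov′
    ... | inj₂ above = covered-start above

    private
      covered-multiple : ∀ k → Covered p (k * m)
      covered-multiple zero    = covered₀
      covered-multiple (suc k) = subst (Covered p) (+-comm (k * m) m) (covered+m (covered-multiple k))

      covered+* : ∀ t {x} → Covered p x → Covered p (x + t * n)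
      covered+* zero    {x} cov = subst (Covered p) (sym (+-identityʳ x)) cov
      covered+* (suc t) {x} cov = subst (Covered p) (+-assoc x n (t * n)) (covered+* t (covered+n cov))

    -- Modulo `n` every `x` is `k * m` for some `k < n`. From `n * m` on, `x` is at least `k * m`,
    -- so the difference is a natural multiple of `n`.
    covered-cofinite : ∀ {x} → n * m ≤ x → Covered p x
    covered-cofinite {x} nm≤x with k , k<n , x≡km ← coprime-residue coprime-m x
      with t , eq ← %-≡∧≤⇒ n (≤-trans (*-monoˡ-≤ m (<⇒≤ k<n)) nm≤x) x≡km =
      subst (Covered p) (sym eq) (covered+* t (covered-multiple k))

  vertex-residue : ∀ {a w c} (p : Walk a w c) {b} → b ∈ vertices p →
    ∃[ k ] k < length w × b % n ≡ (a + k * d) % n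
  vertex-residue {a} (e ∷ p) (here refl) = 0 , z<s , cong (_% n) (sym (+-identityʳ a))
  vertex-residue {a} {s ∷ w} (_∷_ {b = a′} e p) {b} (there b∈) with k , k< , eq ← vertex-residue p b∈ =
    suc k , s<s k< , (begin
      b % n                 ≡⟨ eq ⟩
      (a′ + k * d) % n      ≡⟨ %-congˡ-+ n (k * d) (edge-residue s e) ⟩
      (a + d + k * d) % n   ≡⟨ cong (_% n) (+-assoc a d (k * d)) ⟩
      (a + suc k * d) % n   ∎)

  -- After `suc k` steps the class has moved by `suc k * d`, which is not divisible by `n` because
  -- `0 < suc k < n` and `d` is coprime to `n`.
  later-residue : ∀ {a a′ w c} s → Edge a s a′ → (p : Walk a′ w c) → length w < n →
    ∀ {b} → b ∈ vertices p → b % n ≢ a % n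
  later-residue {a} {a′} s e p w<n {b} b∈ b≡a with k , k< , eq ← vertex-residue p b∈
    with t , eq′ ← %-≡∧≤⇒ n (m≤m+n a (suc k * d)) (begin
      (a + suc k * d) % n   ≡⟨ cong (_% n) (+-assoc a d (k * d)) ⟨
      (a + d + k * d) % n   ≡⟨ %-congˡ-+ n (k * d) (edge-residue s e) ⟨
      (a′ + k * d) % n      ≡⟨ eq ⟨
      b % n                 ≡⟨ b≡a ⟩
      a % n                 ∎)
    with () ← coprime-cancel {t = t} coprime-d (≤-<-trans k< w<n) (+-cancelˡ-≡ a _ _ eq′)

  vertex-determined : ∀ {a w c} (p : Walk a w c) → length w ≤ n → ∀ {b b′} →
    b ∈ vertices p → b′ ∈ vertices p → b % n ≡ b′ % n → b ≡ b′
  vertex-determined (e ∷ p) len (here refl) (here refl) _ = refl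
  vertex-determined (e ∷ p) len (there b∈) (there b′∈) eq =
    vertex-determined p (<⇒≤ len) b∈ b′∈ eq
  vertex-determined (_∷_ {s = s} e p) len (here refl) (there b′∈) eq =
    contradiction (sym eq) (later-residue s e p len b′∈)
  vertex-determined (_∷_ {s = s} e p) len (there b∈) (here refl) eq =
    contradiction eq (later-residue s e p len b∈)

  -- Least elements in the residue classes

  Minimal : Pred ℕ 0ℓ → ℕ → Set
  -- For a set closed under adding `n`, excluding `b - n` excludes every smaller element of the
  -- class; for `b < n` there is no such `y`.
  Minimal S b = S b × (∀ {y} → y + n ≡ b → ¬ S y)

  AllMinimal : Pred ℕ 0ℓ → ∀ {a w c} → Walk a w c → Set
  AllMinimal S p = All (Minimal S) (vertices p)

  -- The vertices of a trace of S are the least elements of S in the residue classes modulo n.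
  Trace : Pred ℕ 0ℓ → List Step → Set
  Trace S w = length w ≡ n × Σ[ p ∈ Walk 0 w 0 ] AllMinimal S p

  trace-cong : ∀ {S S′ : Pred ℕ 0ℓ} → (∀ {x} → S x → S′ x) → (∀ {x} → S′ x → S x) →
    ∀ {w} → Trace S w → Trace S′ w
  trace-cong to from (len , p , min) =
    len , p , All.map (λ (s , s̸) → to s , λ {_} eq → s̸ eq ∘ from) min

  module Minima {S : Pred ℕ 0ℓ} (s₀ : S 0) (S+m : ∀ {x} → S x → S (x + m))
                (S+n : ∀ {x} → S x → S (x + n)) where

    S+* : ∀ t {x} → S x → S (x + t * n)
    S+* zero    {x} s = subst S (sym (+-identityʳ x)) s
    S+* (suc t) {x} s = subst S (+-assoc x n (t * n)) (S+* t (S+n s))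

    minimal₀ : Minimal S 0
    minimal₀ = s₀ , λ {y} eq → contradiction (m+n≡0⇒n≡0 y eq) (≢-nonZero⁻¹ n)

    minimal-≤ : ∀ {b x} → Minimal S b → S x → x % n ≡ b % n → b ≤ x
    minimal-≤ {b} {x} (_ , ∉S) s eq = ≮⇒≥ λ x<b → below x<b (%-≡∧≤⇒ n (<⇒≤ x<b) (sym eq))
      where
      below : x < b → ¬ (∃[ t ] b ≡ x + t * n)
      below x<b (zero  , eq′) = <-irrefl (trans (sym (+-identityʳ x)) (sym eq′)) x<b
      below x<b (suc t , eq′) = ∉S (trans (+-assoc x (t * n) n)
        (trans (cong (λ z → x + z) (+-comm (t * n) n)) (sym eq′))) (S+* t s)

    minimal-unique : ∀ {b b′} → Minimal S b → Minimal S b′ → b % n ≡ b′ % n → b ≡ b′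
    minimal-unique min min′ eq =
      ≤-antisym (minimal-≤ min (proj₁ min′) (sym eq)) (minimal-≤ min′ (proj₁ min) eq)

    private
      start-minimal : ∀ {a w c} (p : Walk a w c) → AllMinimal S p → Minimal S c → Minimal S a
      start-minimal []      _         min = min
      start-minimal (e ∷ p) (min ∷ _) _   = min

    -- The next vertices of both walks are least in the class of `a + d`, hence equal, and an edge
    -- is determined by its ends. The endpoint is not among the vertices, so its minimality is
    -- assumed separately.
    walk-unique : ∀ {a w w′ c} (p : Walk a w c) (q : Walk a w′ c) → Minimal S c →
      AllMinimal S p → AllMinimal S q → length w ≡ length w′ → w ≡ w′
    walk-unique [] [] _ _ _ _ = refl
    walk-unique (_∷_ {s = s} e p) (_∷_ {s = s′} e′ q) min (_ ∷ ps) (_ ∷ qs) len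
      with refl ← minimal-unique (start-minimal p ps min) (start-minimal q qs min)
                    (trans (edge-residue s e) (sym (edge-residue s′ e′)))
      = cong₂ _∷_ (edge-step {s = s} {s′} e e′) (walk-unique p q min ps qs (suc-injective len))

    trace-unique : ∀ {w w′} → Trace S w → Trace S w′ → w ≡ w′
    trace-unique (len , p , ps) (len′ , q , qs) =
      walk-unique p q minimal₀ ps qs (trans len (sym len′))

    private
      covers : ∀ {a w c} (p : Walk a w c) → AllMinimal S p → ∀ {x} → S x →
        ∀ k → k < length w → x % n ≡ (a + k * d) % n → Covered p x
      covers {a} (e ∷ p) (min ∷ _) s zero k< eq = here (minimal-≤ min s eq′ , eq′)
        where eq′ = trans eq (cong (_% n) (+-identityʳ a))
      covers {a} {s ∷ _} (_∷_ {b = b} e p) (_ ∷ ps) {x} sx (suc k) (s<s k<) eq =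
        there (covers p ps sx k k< (begin
          x % n                ≡⟨ eq ⟩
          (a + suc k * d) % n  ≡⟨ cong (_% n) (+-assoc a d (k * d)) ⟨
          (a + d + k * d) % n  ≡⟨ %-congˡ-+ n (k * d) (edge-residue s e) ⟨
          (b + k * d) % n      ∎))

    -- The multiples `k * d` with `k < n` reach every class, so some vertex is least in the class of
    -- `x`. With `covered⇒∈`, this recovers `S` from the word.
    trace⇒covered : ∀ {w} ((_ , p , _) : Trace S w) → ∀ {x} → S x → Covered p x
    trace⇒covered (len , p , ps) {x} s with k , k<n , eq ← coprime-residue coprime-d x =
      covers p ps s k (subst (k <_) (sym len) k<n) eq

    covered⇒∈ : ∀ {w} ((_ , p , _) : Trace S w) → ∀ {x} → Covered p x → S x
    covered⇒∈ (_ , p , ps) {x} cov with b , b∈ , (b≤x , x≡b) ← find cov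
      with t , eq ← %-≡∧≤⇒ n b≤x x≡b = subst S (sym eq) (S+* t (proj₁ (All.lookup ps b∈)))

    module _ (S? : Decidable S) (S+[n+d] : ∀ {x} → S x → S (x + (n + d))) where

      private
        -m : ∀ {b} → m ≤ b → ∀ {y} → y + n ≡ b ∸ m → y + m + n ≡ b
        -m {b} m≤b {y} eq = trans (+-assoc y m n) (trans (cong (λ z → y + z) (+-comm m n))
          (trans (sym (+-assoc y n m)) (trans (cong (_+ m) eq) (m∸n+n≡m m≤b))))

        cancel-d : ∀ {b y} → y + n ≡ b + d → y + m ≡ b
        cancel-d {b} {y} eq = +-cancelʳ-≡ d _ b
          (trans (+-assoc y m d) (trans (cong (λ z → y + z) m+d≡n) eq))

        go-down : ∀ {b} → m ≤ b → Minimal S b → S (b ∸ m) → Minimal S (b ∸ m)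
        go-down m≤b (_ , ∉S) s = s , λ eq sy → ∉S (-m m≤b eq) (S+m sy)

        no-down⇒level : ∀ {b} → (∀ {y} → y + m ≡ b → ¬ S y) → S (b + d) → Minimal S (b + d)
        no-down⇒level none s = s , none ∘ cancel-d

      -- The next vertex is the first member of `S` among `b - m`, `b + d` and `b + d + n`. The last
      -- is always a member. Nothing lower occurs, since `b - m - n` in `S` would put `b - n` into
      -- `S`.
      next-minimal : ∀ {b} → Minimal S b → ∃[ s ] ∃[ b′ ] Edge b s b′ × Minimal S b′
      next-minimal {b} min with m ≤? b | S? (b ∸ m) | S? (b + d)
      ... | yes m≤b | yes s | _ = down , b ∸ m ,
        trans (cong (λ z → b ∸ m + z) (trans (*-identityˡ n) (sym m+d≡n)))
          (trans (sym (+-assoc (b ∸ m) m d)) (trans (cong (_+ d) (m∸n+n≡m m≤b)) (sym (+-identityʳ (b + d))))) ,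
        go-down m≤b min s
      ... | yes m≤b | no ∉S | yes s = level , b + d , refl , no-down⇒level
        (λ { {y} refl → ∉S ∘ subst S (sym (m+n∸n≡m y m)) }) s
      ... | no m≰b | _ | yes s = level , b + d , refl , no-down⇒level
        (λ { {y} refl → contradiction (m≤n+m m y) m≰b }) s
      ... | _ | _ | no ∉S = up , b + d + n ,
        trans (+-identityʳ (b + d + n)) (cong (λ z → b + d + z) (sym (*-identityˡ n))) ,
        subst S (trans (cong (λ z → b + z) (+-comm n d)) (sym (+-assoc b d n))) (S+[n+d] (proj₁ min)) ,
        λ eq → subst (λ z → ¬ S z) (sym (+-cancelʳ-≡ n _ _ eq)) ∉S

      walk-from : ∀ k {b} → Minimal S b → ∃[ w ] ∃[ c ] length w ≡ k × Minimal S c ×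
        (Σ[ p ∈ Walk b w c ] AllMinimal S p)
      walk-from zero    min = [] , _ , refl , min , [] , []
      walk-from (suc k) min with s , b′ , e , min′ ← next-minimal min
        with w , c , len , minc , p , ps ← walk-from k min′ =
        s ∷ w , c , cong suc len , minc , e ∷ p , min ∷ ps

      trace : ∃[ w ] Trace S w
      trace with w , c , len , minc , p , ps ← walk-from n minimal₀
        -- After `n` steps the walk is back in the class of 0, whose least element is 0, so it
        -- closes.
        with refl ← minimal-unique minc minimal₀ (%-step n (downs w) (d + ups w) (begin
          c + downs w * n            ≡⟨ walk-height p ⟩
          length w * d + ups w * n   ≡⟨ cong (λ z → z * d + ups w * n) len ⟩
          n * d + ups w * n          ≡⟨ cong (_+ ups w * n) (*-comm n d) ⟩
          d * n + ups w * n          ≡⟨ *-distribʳ-+ n d (ups w) ⟨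
          (d + ups w) * n            ∎))
        = w , len , p , ps

  -- If `y + n` is a vertex and `y` lies above a vertex `b`, the two vertices share a class and so
  -- coincide, although `b ≤ y < y + n`.
  covered-trace : ∀ {w} (|w|≡n : length w ≡ n) (p : Walk 0 w 0) → Trace (Covered p) w
  covered-trace {w} len p = len , p , All.tabulate λ {b} b∈ →
    lose b∈ (≤-refl , refl) , λ { {y} refl cov → no-lower b∈ (find cov) }
    where
    no-lower : ∀ {y} → y + n ∈ vertices p → ¬ (∃[ b ] b ∈ vertices p × Above b y)
    no-lower {y} y+n∈ (b , b∈ , b≤y , y≡b) = <⇒≢ (≤-<-trans b≤y (m<m+n y (>-nonZero⁻¹ n)))
      (vertex-determined p (≤-reflexive len) b∈ y+n∈ (sym (trans ([m+n]%n≡m%n y n) y≡b)))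

-- Counting words

module _ {A B : Set} where

  concatMap-unique : (f : A → List B) → ∀ {xs} → Unique xs → (∀ {x} → x ∈ xs → Unique (f x)) →
    (∀ {x y z} → x ∈ xs → y ∈ xs → z ∈ f x → z ∈ f y → x ≡ y) → Unique (concatMap f xs)
  concatMap-unique f []          fxs! inj = []
  concatMap-unique f (x∉xs ∷ xs!) fxs! inj =
    Unique.++⁺ (fxs! (here refl))
      (concatMap-unique f xs! (fxs! ∘ there) (λ x∈ y∈ → inj (there x∈) (there y∈)))
      λ (z∈fx , z∈rest) → let y , y∈xs , z∈fy = find (∈-concatMap⁻ f z∈rest) in
        All.lookup x∉xs y∈xs (inj (here refl) (there y∈xs) z∈fx z∈fy)

  length-concatMap : (f : A → List B) → ∀ xs → length (concatMap f xs) ≡ sum (map (length ∘ f) xs)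
  length-concatMap f []       = refl
  length-concatMap f (x ∷ xs) =
    trans (length-++ (f x)) (cong (λ z → length (f x) + z) (length-concatMap f xs))

  length-concatMap-const : (f : A → List B) → ∀ {n} → (∀ x → length (f x) ≡ n) →
    ∀ xs → length (concatMap f xs) ≡ length xs * n
  length-concatMap-const f len []       = refl
  length-concatMap-const f len (x ∷ xs) =
    trans (length-++ (f x)) (cong₂ _+_ (len x) (length-concatMap-const f len xs))

module _ {A : Set} where

  unique-length : ∀ {xs ys : List A} → Unique xs → Unique ys →
    (∀ {x} → x ∈ xs → x ∈ ys) → (∀ {x} → x ∈ ys → x ∈ xs) → length xs ≡ length ys
  unique-length xs! ys! to from = ↭-length (∼bag⇒↭ (unique∧set⇒bag xs! ys! (mk⇔ to from)))

  rotate : ℕ → List A → List A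
  rotate k xs = drop k xs ++ take k xs

  rotate-length : ∀ (xs ys : List A) → rotate (length xs) (xs ++ ys) ≡ ys ++ xs
  rotate-length xs ys = cong₂ _++_ (dropped xs) (taken xs)
    where
    dropped : ∀ xs → drop (length xs) (xs ++ ys) ≡ ys
    dropped []       = refl
    dropped (x ∷ xs) = dropped xs
    taken : ∀ xs → take (length xs) (xs ++ ys) ≡ xs
    taken []       = refl
    taken (x ∷ xs) = cong (x ∷_) (taken xs)

  ++-common : ∀ (xs : List A) {ys} xs′ {ys′} → xs ++ ys ≡ xs′ ++ ys′ → length xs′ ≤ length xs →
    ∃[ zs ] xs ≡ xs′ ++ zs × ys′ ≡ zs ++ ys
  ++-common xs       []         eq _ = xs , refl , sym eq
  ++-common (x ∷ xs) (x′ ∷ xs′) eq (s≤s ≤) with refl , eq′ ← ∷-injective eq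
    with zs , refl , eq″ ← ++-common xs xs′ eq′ ≤ = zs , refl , eq″

module _ {a ℓ} (S : Setoid a ℓ) {B : Set} where

  open Setoid S using (Carrier; _≈_)

  enumerate : ∀ {xs} → Unique xs → (f : Carrier → B) → (∀ {x y} → x ≈ y → f x ≡ f y) →
    (∀ {x y} → f x ≡ f y → x ≈ y) → (∀ x → f x ∈ xs) →
    (∀ {b} → b ∈ xs → ∃[ x ] f x ≡ b) → HasCardinality S (length xs)
  enumerate {xs} xs! f f-cong f-injective f∈ f-onto = record
    { to        = to
    ; from      = from
    ; to-cong   = to-cong
    ; from-cong = λ { refl → Setoid.refl S }
    ; inverse   = (λ y≈ → trans (to-cong y≈) (to-from _)) , λ { {x} refl → f-injective (from-to x) }
    }
    where
    to : Carrier → Fin (length xs)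
    to x = index (f∈ x)
    from : Fin (length xs) → Carrier
    from i = proj₁ (f-onto (∈-lookup i))
    -- Without repetitions in `xs` a membership proof is unique, so the index depends on the element
    -- alone.
    index-cong : ∀ {b b′} → b ≡ b′ → (b∈ : b ∈ xs) (b′∈ : b′ ∈ xs) → index b∈ ≡ index b′∈
    index-cong refl b∈ b′∈ = cong index (unique⇒irrelevant xs! b∈ b′∈)
    index-∈-lookup : ∀ {ys : List B} i → index (∈-lookup {xs = ys} i) ≡ i
    index-∈-lookup {_ ∷ _} Fin.zero    = refl
    index-∈-lookup {_ ∷ _} (Fin.suc i) = cong Fin.suc (index-∈-lookup i)
    to-cong : ∀ {x y} → x ≈ y → to x ≡ to y
    to-cong x≈y = index-cong (f-cong x≈y) _ _
    to-from : ∀ i → to (from i) ≡ i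
    to-from i = trans (index-cong (proj₂ (f-onto (∈-lookup i))) _ (∈-lookup i)) (index-∈-lookup i)
    from-to : ∀ x → f (from (to x)) ≡ f x
    from-to x = trans (proj₂ (f-onto (∈-lookup (to x)))) (sym (lookup-index (f∈ x)))

-- The argument counts the steps `s` still to be placed; at 0 no word can begin with `s`.
prepend : Step → (ℕ → List (List Step)) → ℕ → List (List Step)
prepend s f zero    = []
prepend s f (suc a) = map (s ∷_) (f a)

words : (k a b : ℕ) → List (List Step)
words zero zero zero = [] ∷ []
words zero _    _    = []
words (suc k) a b    =
  prepend up (λ a → words k a b) a ++ prepend down (words k a) b ++ map (level ∷_) (words k a b)

∈-prepend⁻ : ∀ {s} f a {w} → w ∈ prepend s f a → ∃[ a′ ] ∃[ w′ ] a ≡ suc a′ × w′ ∈ f a′ × w ≡ s ∷ w′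
∈-prepend⁻ {s} f (suc a) w∈ with w′ , w′∈ , eq ← ∈-map⁻ (s ∷_) w∈ = a , w′ , refl , w′∈ , eq

∈-words⁻ : ∀ k {a b w} → w ∈ words k a b → length w ≡ k × ups w ≡ a × downs w ≡ b
∈-words⁻ zero {zero} {zero} (here refl) = refl , refl , refl
∈-words⁻ (suc k) {a} {b} w∈ with ∈-++⁻ (prepend up (λ a → words k a b) a) w∈
... | inj₁ w∈₁ with _ , _ , refl , w′∈ , refl ← ∈-prepend⁻ (λ a → words k a b) a w∈₁
  with len , refl , refl ← ∈-words⁻ k w′∈ = cong suc len , refl , refl
... | inj₂ w∈₂ with ∈-++⁻ (prepend down (words k a) b) w∈₂
...   | inj₁ w∈₁ with _ , _ , refl , w′∈ , refl ← ∈-prepend⁻ (words k a) b w∈₁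
  with len , refl , refl ← ∈-words⁻ k w′∈ = cong suc len , refl , refl
...   | inj₂ w∈₃ with _ , w′∈ , refl ← ∈-map⁻ (level ∷_) w∈₃
  with len , refl , refl ← ∈-words⁻ k w′∈ = cong suc len , refl , refl

∈-words⁺ : ∀ w → w ∈ words (length w) (ups w) (downs w)
∈-words⁺ []          = here refl
∈-words⁺ (up ∷ w)    = ∈-++⁺ˡ (∈-map⁺ (up ∷_) (∈-words⁺ w))
∈-words⁺ (down ∷ w)  = ∈-++⁺ʳ (prepend up _ (ups w)) (∈-++⁺ˡ (∈-map⁺ (down ∷_) (∈-words⁺ w)))
∈-words⁺ (level ∷ w) = ∈-++⁺ʳ (prepend up _ (ups w)) (∈-++⁺ʳ (prepend down _ (downs w))
  (∈-map⁺ (level ∷_) (∈-words⁺ w)))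

words-unique : ∀ k a b → Unique (words k a b)
words-unique zero    zero    zero    = [] ∷ []
words-unique zero    zero    (suc b) = []
words-unique zero    (suc a) b       = []
words-unique (suc k) a       b       =
  Unique.++⁺ (prepend-unique up (λ a → words k a b) a (λ a → words-unique k a b))
    (Unique.++⁺ (prepend-unique down (words k a) b (words-unique k a))
      (Unique.map⁺ (proj₂ ∘ ∷-injective) (words-unique k a b))
      λ (w∈₁ , w∈₂) → down≢level (∈-prepend⁻ (words k a) b w∈₁) (∈-map⁻ (level ∷_) w∈₂))
    λ (w∈₁ , w∈₂) → up≢ (∈-prepend⁻ (λ a → words k a b) a w∈₁) (∈-++⁻ (prepend down (words k a) b) w∈₂)
  where
  prepend-unique : ∀ s f a → (∀ a → Unique (f a)) → Unique (prepend s f a)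
  prepend-unique s f zero    f! = []
  prepend-unique s f (suc a) f! = Unique.map⁺ (proj₂ ∘ ∷-injective) (f! a)
  down≢level : ∀ {w} → ∃[ b′ ] ∃[ w′ ] b ≡ suc b′ × w′ ∈ words k a b′ × w ≡ down ∷ w′ →
    ¬ (∃[ w′ ] w′ ∈ words k a b × w ≡ level ∷ w′)
  down≢level (_ , _ , _ , _ , refl) (_ , _ , ())
  up≢ : ∀ {w} → ∃[ a′ ] ∃[ w′ ] a ≡ suc a′ × w′ ∈ words k a′ b × w ≡ up ∷ w′ →
    ¬ (w ∈ prepend down (words k a) b ⊎ w ∈ map (level ∷_) (words k a b))
  up≢ (_ , _ , _ , _ , refl) (inj₁ w∈) with _ , _ , _ , _ , () ← ∈-prepend⁻ (words k a) b w∈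
  up≢ (_ , _ , _ , _ , refl) (inj₂ w∈) with _ , _ , () ← ∈-map⁻ (level ∷_) w∈

length-words-suc : ∀ k a b → length (words (suc k) a b) ≡
  length (prepend up (λ a → words k a b) a) + (length (prepend down (words k a) b) + length (words k a b))
length-words-suc k a b = trans (length-++ (prepend up _ a)) (cong (λ z → length (prepend up _ a) + z)
  (trans (length-++ (prepend down _ b))
    (cong (λ z → length (prepend down _ b) + z) (length-map (level ∷_) (words k a b)))))

words-none : ∀ k a b → k < a + b → length (words k a b) ≡ 0
words-none zero    zero    (suc b) _  = refl
words-none zero    (suc a) b       _  = refl
words-none (suc k) a       b       k< = trans (length-words-suc k a b)
  (cong₂ _+_ (none-up a k<) (cong₂ _+_ (none-down b k<) (words-none k a b (<-trans (n<1+n k) k<))))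
  where
  none-up : ∀ a → suc k < a + b → length (prepend up (λ a → words k a b) a) ≡ 0
  none-up zero    _        = refl
  none-up (suc a) (s<s k<) = trans (length-map _ (words k a b)) (words-none k a b k<)
  none-down : ∀ b → suc k < a + b → length (prepend down (words k a) b) ≡ 0
  none-down zero    _  = refl
  none-down (suc b) k< = trans (length-map _ (words k a b))
    (words-none k a b (s<s⁻¹ (subst (suc k <_) (+-suc a b) k<)))

-- The multinomial recursion cleared of denominators: the words that begin with `up`, `down` and
-- `level` contribute `a * k !`, `b * k !` and `c * k !`.
length-words : ∀ k a b c → a + b + c ≡ k → length (words k a b) * (a ! * b ! * c !) ≡ k !
length-words zero    zero zero zero _  = refl
length-words (suc k) a    b    c    eq = begin
  length (words (suc k) a b) * F               ≡⟨ cong (_* F) (length-words-suc k a b) ⟩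
  (U + (D + L)) * F                            ≡⟨ shuffle U D L F ⟩
  U * F + (D * F + L * F)                      ≡⟨ cong₂ _+_ (by-up a eq) (cong₂ _+_ (by-down b eq) (by-level c eq)) ⟩
  a * k ! + (b * k ! + c * k !)                ≡⟨ shuffle′ a b c (k !) ⟩
  (a + b + c) * k !                            ≡⟨ cong (_* k !) eq ⟩
  suc k !                                      ∎
  where
  F = a ! * b ! * c !
  U = length (prepend up (λ a → words k a b) a)
  D = length (prepend down (words k a) b)
  L = length (words k a b)
  shuffle : ∀ u d l f → (u + (d + l)) * f ≡ u * f + (d * f + l * f)
  shuffle = solve-∀
  shuffle′ : ∀ a b c f → a * f + (b * f + c * f) ≡ (a + b + c) * f
  shuffle′ = solve-∀
  by-up : ∀ a → a + b + c ≡ suc k →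
    length (prepend up (λ a → words k a b) a) * (a ! * b ! * c !) ≡ a * k !
  by-up zero    _  = refl
  by-up (suc a) eq = begin
    length (map (up ∷_) (words k a b)) * (suc a * a ! * b ! * c !)
      ≡⟨ cong (_* (suc a * a ! * b ! * c !)) (length-map _ (words k a b)) ⟩
    length (words k a b) * (suc a * a ! * b ! * c !)
      ≡⟨ pull (length (words k a b)) a (a !) (b !) (c !) ⟩
    suc a * (length (words k a b) * (a ! * b ! * c !))
      ≡⟨ cong (suc a *_) (length-words k a b c (suc-injective eq)) ⟩
    suc a * k !
      ∎
    where
    pull : ∀ l a x y z → l * (suc a * x * y * z) ≡ suc a * (l * (x * y * z))
    pull = solve-∀
  by-down : ∀ b → a + b + c ≡ suc k →
    length (prepend down (words k a) b) * (a ! * b ! * c !) ≡ b * k !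
  by-down zero    _  = refl
  by-down (suc b) eq = begin
    length (map (down ∷_) (words k a b)) * (a ! * (suc b * b !) * c !)
      ≡⟨ cong (_* (a ! * (suc b * b !) * c !)) (length-map _ (words k a b)) ⟩
    length (words k a b) * (a ! * (suc b * b !) * c !)
      ≡⟨ pull (length (words k a b)) b (a !) (b !) (c !) ⟩
    suc b * (length (words k a b) * (a ! * b ! * c !))
      ≡⟨ cong (suc b *_) (length-words k a b c (suc-injective (trans (cong (_+ c) (sym (+-suc a b))) eq))) ⟩
    suc b * k !
      ∎
    where
    pull : ∀ l b x y z → l * (x * (suc b * y) * z) ≡ suc b * (l * (x * y * z))
    pull = solve-∀
  by-level : ∀ c → a + b + c ≡ suc k → length (words k a b) * (a ! * b ! * c !) ≡ c * k !
  -- Here `a + b` is `suc k`, too many steps for a word of length `k`.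
  by-level zero    eq = cong (_* (a ! * b ! * 1))
    (words-none k a b (≤-reflexive (trans (sym eq) (+-identityʳ (a + b)))))
  by-level (suc c) eq = begin
    length (words k a b) * (a ! * b ! * (suc c * c !))
      ≡⟨ pull (length (words k a b)) c (a !) (b !) (c !) ⟩
    suc c * (length (words k a b) * (a ! * b ! * c !))
      ≡⟨ cong (suc c *_) (length-words k a b c (suc-injective (trans (sym (+-suc (a + b) c)) eq))) ⟩
    suc c * k !
      ∎
    where
    pull : ∀ l c x y z → l * (x * y * (suc c * z)) ≡ suc c * (l * (x * y * z))
    pull = solve-∀

length-words≡multinomial : ∀ {k a b c} → a + b + c ≡ k → length (words k a b) ≡ multinomial k a b c
length-words≡multinomial {k} {a} {b} {c} eq =
  sym (trans (/-congˡ {{nz}} (sym (length-words k a b c eq))) (m*n/n≡m _ _ {{nz}}))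
  where
  nz : NonZero (a ! * b ! * c !)
  nz = m*n≢0 _ _ {{m*n≢0 _ _ {{a !≢0}} {{b !≢0}}}} {{c !≢0}}

-- The cycle lemma

module Counting (m d n : ℕ) .{{_ : NonZero n}} (m+d≡n : m + d ≡ n)
                (coprime-d : Coprime d n) (coprime-m : Coprime m n) where

  open Walks m d n m+d≡n coprime-d coprime-m

  -- The index `i` counts the steps up. With `i + d` steps down, `m - 2 * i` level steps remain,
  -- whence the range of `i`.
  balancedWords : List (List Step)
  balancedWords = concatMap (λ i → words n i (i + d)) (upTo (suc ⌊ m /2⌋))

  closedWords : List (List Step)
  closedWords = filter (λ w → walk? 0 w 0) balancedWords

  ups+downs≤length : ∀ w → ups w + downs w ≤ length w
  ups+downs≤length []          = z≤n
  ups+downs≤length (up ∷ w)    = s≤s (ups+downs≤length w)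
  ups+downs≤length (level ∷ w) = m≤n⇒m≤1+n (ups+downs≤length w)
  ups+downs≤length (down ∷ w)  =
    ≤-trans (≤-reflexive (+-suc (ups w) (downs w))) (s≤s (ups+downs≤length w))

  ∈-balancedWords⁺ : ∀ {w} → Balanced w → w ∈ balancedWords
  ∈-balancedWords⁺ {w} (len , bal) = ∈-concatMap⁺ (λ i → words n i (i + d)) (lose
    (∈-upTo⁺ (s≤s (≤-trans (≤-reflexive (n≡⌊n+n/2⌋ (ups w))) (⌊n/2⌋-mono 2u≤m))))
    (subst₂ (λ k b → w ∈ words k (ups w) b) len (trans bal (+-comm d (ups w))) (∈-words⁺ w)))
    where
    2u≤m : ups w + ups w ≤ m
    2u≤m = +-cancelʳ-≤ d _ m (≤-trans (≤-reflexive
      (trans (+-assoc (ups w) (ups w) d)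
        (cong (λ z → ups w + z) (trans (+-comm (ups w) d) (sym bal)))))
      (≤-trans (ups+downs≤length w) (≤-reflexive (trans len (sym m+d≡n)))))

  ∈-balancedWords⁻ : ∀ {w} → w ∈ balancedWords → Balanced w
  ∈-balancedWords⁻ w∈
    with i , _ , w∈i ← find (∈-concatMap⁻ (λ i → words n i (i + d)) {xs = upTo (suc ⌊ m /2⌋)} w∈)
    with len , refl , down≡ ← ∈-words⁻ n w∈i = len , trans down≡ (+-comm i d)

  balancedWords-unique : Unique balancedWords
  balancedWords-unique = concatMap-unique _ (Unique.upTo⁺ (suc ⌊ m /2⌋))
    (λ {i} _ → words-unique n i (i + d))
    (λ _ _ w∈i w∈j → trans (sym (proj₁ (proj₂ (∈-words⁻ n w∈i)))) (proj₁ (proj₂ (∈-words⁻ n w∈j))))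

  length-balancedWords :
    length balancedWords ≡ ∑[0≤ i ≤ ⌊ m /2⌋ ] multinomial n i (i + d) (m ∸ 2 * i)
  length-balancedWords = trans (length-concatMap (λ i → words n i (i + d)) (upTo (suc ⌊ m /2⌋)))
    (cong sum (map-cong-local (All.map (λ {i} i< → length-words≡multinomial {a = i} {i + d} (total (s≤s⁻¹ i<)))
      (all-upTo (suc ⌊ m /2⌋)))))
    where
    total : ∀ {i} → i ≤ ⌊ m /2⌋ → i + (i + d) + (m ∸ 2 * i) ≡ n
    total {i} i≤ = begin
      i + (i + d) + (m ∸ 2 * i)  ≡⟨ shuffle i d (m ∸ 2 * i) ⟩
      m ∸ 2 * i + 2 * i + d      ≡⟨ cong (_+ d) (m∸n+n≡m 2i≤m) ⟩
      m + d                      ≡⟨ m+d≡n ⟩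
      n                          ∎
      where
      shuffle : ∀ i d z → i + (i + d) + z ≡ z + 2 * i + d
      shuffle = solve-∀
      2i≤m : 2 * i ≤ m
      2i≤m = ≤-trans (≤-reflexive (cong (λ z → i + z) (+-identityʳ i)))
        (≤-trans (+-mono-≤ i≤ (≤-trans i≤ (⌊n/2⌋≤⌈n/2⌉ m))) (≤-reflexive (⌊n/2⌋+⌈n/2⌉≡n m)))

  ∈-closedWords⁺ : ∀ {w} → length w ≡ n → Walk 0 w 0 → w ∈ closedWords
  ∈-closedWords⁺ len p =
    ∈-filter⁺ (λ w → walk? 0 w 0) (∈-balancedWords⁺ (closed⇒balanced len p)) p

  ∈-closedWords⁻ : ∀ {w} → w ∈ closedWords → length w ≡ n × Walk 0 w 0
  ∈-closedWords⁻ w∈ with w∈′ , p ← ∈-filter⁻ (λ w → walk? 0 w 0) {xs = balancedWords} w∈ =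
    proj₁ (∈-balancedWords⁻ w∈′) , p

  closedWords-unique : Unique closedWords
  closedWords-unique = Unique.filter⁺ (λ w → walk? 0 w 0) balancedWords-unique

  balanced-comm : ∀ u {v} → Balanced (u ++ v) → Balanced (v ++ u)
  balanced-comm u {v} (len , bal) =
    trans (length-++-comm v u) len ,
    trans (sum-comm downs₁ v u) (trans bal (cong (λ z → d + z) (sum-comm ups₁ u v)))
    where
    sum-comm : ∀ (f : Step → ℕ) u v → sum (map f (u ++ v)) ≡ sum (map f (v ++ u))
    sum-comm f u v = begin
      sum (map f (u ++ v))            ≡⟨ cong sum (map-++ f u v) ⟩
      sum (map f u ++ map f v)        ≡⟨ sum-++ (map f u) (map f v) ⟩
      sum (map f u) + sum (map f v)   ≡⟨ +-comm (sum (map f u)) _ ⟩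
      sum (map f v) + sum (map f u)   ≡⟨ sum-++ (map f v) (map f u) ⟨
      sum (map f v ++ map f u)        ≡⟨ cong sum (map-++ f v u) ⟨
      sum (map f (v ++ u))            ∎

  balanced-rotate : ∀ k {w} → Balanced w → Balanced (rotate k w)
  balanced-rotate k {w} bal = balanced-comm (take k w) (subst Balanced (sym (take++drop≡id k w)) bal)

  rotations : List Step → List (List Step)
  rotations w = applyUpTo (λ k → rotate k w) n

  private
    -- Comparing the two factorisations gives `z` with `drop k w ≡ drop k′ w′ ++ z` and
    -- `take k′ w′ ≡ z ++ take k w`. So moving `z` from front to back turns `w′` into `w`; both are
    -- closed, and `closed-rotation-unique` forces `z` to be empty.
    rotate-injective-≤ : ∀ {k k′ w w′} → k ≤ k′ → k′ < n → w ∈ closedWords → w′ ∈ closedWords →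
      rotate k w ≡ rotate k′ w′ → k ≡ k′ × w ≡ w′
    rotate-injective-≤ {k} {k′} {w} {w′} k≤k′ k′<n w∈ w′∈ eq
      with len , p ← ∈-closedWords⁻ w∈ | len′ , p′ ← ∈-closedWords⁻ w′∈
      with z , drop≡ , take≡ ← ++-common (drop k w) (drop k′ w′) eq
        (subst₂ _≤_ (sym (trans (length-drop k′ w′) (cong (_∸ k′) len′)))
                    (sym (trans (length-drop k w) (cong (_∸ k) len))) (∸-monoʳ-≤ n k≤k′))
      with refl ← closed-rotation-unique z (take k w ++ drop k′ w′)
        (≤-<-trans (≤-trans (m≤m+n (length z) _) (≤-reflexive (sym (trans (cong length take≡) (length-++ z)))))
          (≤-<-trans (≤-trans (≤-reflexive (length-take k′ w′)) (m⊓n≤m k′ _)) k′<n))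
        (subst (λ w → Walk 0 w 0) (trans (sym (take++drop≡id k′ w′))
          (trans (cong (_++ drop k′ w′) take≡) (++-assoc z (take k w) (drop k′ w′)))) p′)
        (subst (λ w → Walk 0 w 0) (trans (sym (take++drop≡id k w))
          (trans (cong (take k w ++_) drop≡) (sym (++-assoc (take k w) (drop k′ w′) z)))) p)
      = trans (sym (take-k len (≤-trans k≤k′ (<⇒≤ k′<n))))
          (trans (sym (cong length take≡)) (take-k len′ (<⇒≤ k′<n))) ,
        trans (sym (take++drop≡id k w)) (trans (cong₂ _++_ (sym take≡)
          (trans drop≡ (++-identityʳ _))) (take++drop≡id k′ w′))
      where
      take-k : ∀ {k} {w : List Step} → length w ≡ n → k ≤ n → length (take k w) ≡ k
      take-k {k} {w} len k≤n = trans (length-take k w) (m≤n⇒m⊓n≡m (≤-trans k≤n (≤-reflexive (sym len))))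

  rotate-injective : ∀ {k k′ w w′} → k < n → k′ < n → w ∈ closedWords → w′ ∈ closedWords →
    rotate k w ≡ rotate k′ w′ → k ≡ k′ × w ≡ w′
  rotate-injective {k} {k′} k<n k′<n w∈ w′∈ eq with ≤-total k k′
  ... | inj₁ k≤k′ = rotate-injective-≤ k≤k′ k′<n w∈ w′∈ eq
  ... | inj₂ k′≤k with k′≡k , w′≡w ← rotate-injective-≤ k′≤k k<n w′∈ w∈ (sym eq) = sym k′≡k , sym w′≡w

  rotations-unique : Unique (concatMap rotations closedWords)
  rotations-unique = concatMap-unique rotations closedWords-unique
    (λ {w} w∈ → Unique.applyUpTo⁺₁ (λ k → rotate k w) n λ i<j j<n eq →
      <⇒≢ i<j (proj₁ (rotate-injective (<-trans i<j j<n) j<n w∈ w∈ eq)))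
    λ {w} {w′} w∈ w′∈ z∈ z∈′ →
      let k , k<n , eq = ∈-applyUpTo⁻ (λ k → rotate k w) z∈
          k′ , k′<n , eq′ = ∈-applyUpTo⁻ (λ k → rotate k w′) z∈′
      in proj₂ (rotate-injective k<n k′<n w∈ w′∈ (trans (sym eq) eq′))

  rotation∈balancedWords : ∀ {w} → w ∈ concatMap rotations closedWords → w ∈ balancedWords
  rotation∈balancedWords z∈
    with w , w∈ , z∈w ← find (∈-concatMap⁻ rotations {xs = closedWords} z∈)
    with k , _ , refl ← ∈-applyUpTo⁻ (λ k → rotate k w) z∈w
    with len , p ← ∈-closedWords⁻ w∈
    = ∈-balancedWords⁺ (balanced-rotate k (closed⇒balanced len p))

  balancedWord∈rotations : ∀ {w} → w ∈ balancedWords → w ∈ concatMap rotations closedWords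
  balancedWord∈rotations {w} w∈ with bal ← ∈-balancedWords⁻ w∈
    with closed-rotation w bal
  -- Rotating by `length v` would mean by `n`, outside the range of `rotations`; rotation by 0
  -- serves instead.
  ... | [] , v , refl , p = ∈-concatMap⁺ rotations (lose
    (∈-closedWords⁺ (proj₁ bal) (subst (λ w → Walk 0 w 0) (++-identityʳ v) p))
    (subst (_∈ rotations v) (++-identityʳ v) (∈-applyUpTo⁺ (λ k → rotate k v) (>-nonZero⁻¹ n))))
  ... | u@(_ ∷ _) , v , refl , p = ∈-concatMap⁺ rotations (lose
    (∈-closedWords⁺ (proj₁ (balanced-comm u bal)) p)
    (subst (_∈ rotations (v ++ u)) (rotate-length v u) (∈-applyUpTo⁺ (λ k → rotate k (v ++ u))
      (<-≤-trans (m<n+m (length v) z<s) (≤-reflexive (trans (sym (length-++ u)) (proj₁ bal)))))))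

  -- The `n` rotations of the closed words, taken together, list every balanced word exactly once.
  length-closedWords : length closedWords * n ≡ length balancedWords
  length-closedWords = trans
    (sym (length-concatMap-const rotations (λ w → length-applyUpTo (λ k → rotate k w) n) closedWords))
    (unique-length rotations-unique balancedWords-unique rotation∈balancedWords balancedWord∈rotations)

-- Simultaneous cores and closed words

module Cores (m d : ℕ) .{{_ : NonZero m}} (coprime : Coprime m d) where

  private
    n : ℕ
    n = m + d

    coprime-d : Coprime d n
    coprime-d = Coprime.sym (subst (λ k → Coprime k d) (+-comm d m) (coprime-+ coprime))

    coprime-m : Coprime m n
    coprime-m = Coprime.sym (coprime-+ (Coprime.sym coprime))

    m+2d≡n+d : m + 2 * d ≡ n + d
    m+2d≡n+d = trans (cong (λ z → m + (d + z)) (+-identityʳ d)) (sym (+-assoc m d d))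

  open Walks m d n refl coprime-d coprime-m
  open Counting m d n refl coprime-d coprime-m public

  Core : Set
  Core = SimultaneousCore m n (m + 2 * d)

  module CoreMinima (x : Core) where
    private
      p     = proj₁ x
      core₁ = proj₁ (proj₂ x)
      core₂ = proj₁ (proj₂ (proj₂ x))
      core₃ = proj₂ (proj₂ (proj₂ x))

    open Minima {Horizontal p} (horizontal₀ p) (core⇒closed p core₁) (core⇒closed p core₂) public

    horizontal+[n+d] : ∀ {z} → Horizontal p z → Horizontal p (z + (n + d))
    horizontal+[n+d] {z} h = subst (λ k → Horizontal p (z + k)) m+2d≡n+d (core⇒closed p core₃ h)

    core-trace : ∃[ w ] Trace (Horizontal p) w
    core-trace = trace (horizontal? p) horizontal+[n+d]

  open CoreMinima using (core-trace)

  word : Core → List Step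
  word = proj₁ ∘ core-trace

  word-trace : ∀ x → Trace (Horizontal (proj₁ x)) (word x)
  word-trace = proj₂ ∘ core-trace

  open Setoid (simultaneousCores m n (m + 2 * d)) using (_≈_)

  word-cong : ∀ {x y} → x ≈ y → word x ≡ word y
  word-cong {x} {y} x≈y = CoreMinima.trace-unique y
    (trace-cong (horizontal-cong {proj₁ x} {proj₁ y} x≈y)
                (horizontal-cong {proj₁ y} {proj₁ x} (sym ∘ x≈y)) (word-trace x))
    (word-trace y)

  word-injective : ∀ {x y} → word x ≡ word y → x ≈ y
  word-injective {x} {y} eq = parts-determined (proj₁ x) (proj₁ y)
    (transport x y (word-trace x) (subst (Trace _) (sym eq) (word-trace y)))
    (transport y x (subst (Trace _) (sym eq) (word-trace y)) (word-trace x))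
    where
    transport : ∀ x y {w} → Trace (Horizontal (proj₁ x)) w → Trace (Horizontal (proj₁ y)) w →
      ∀ {z} → Horizontal (proj₁ x) z → Horizontal (proj₁ y) z
    transport x y t t′ = CoreMinima.covered⇒∈ y t′ ∘
      covered-irrelevant (proj₁ (proj₂ t)) (proj₁ (proj₂ t′)) ∘ CoreMinima.trace⇒covered x t

  word∈closedWords : ∀ x → word x ∈ closedWords
  word∈closedWords x = ∈-closedWords⁺ (proj₁ (word-trace x)) (proj₁ (proj₂ (word-trace x)))

  -- The word of a core is found by search in its path, so it is not `w` by computation. But `w`
  -- traces `Covered p`, which is the set of horizontal steps of the core, and traces are unique.
  word-onto : ∀ {w} → w ∈ closedWords → ∃[ x ] word x ≡ w
  word-onto {w} w∈ = core , CoreMinima.trace-unique core (word-trace core)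
    (trace-cong ⊆horizontal horizontal⊆ (covered-trace (proj₁ len×p) p))
    where
    len×p = ∈-closedWords⁻ w∈
    p = proj₂ len×p
    open Closed (proj₁ len×p) p
    open FromSteps (covered? p)
    λ′ : Partition
    λ′ = partition covered₀ (n * m) covered-cofinite
    ⊆horizontal : ∀ {x} → Covered p x → Horizontal λ′ x
    ⊆horizontal = partition-horizontal⇐ covered₀ (n * m) covered-cofinite
    horizontal⊆ : ∀ {x} → Horizontal λ′ x → Covered p x
    horizontal⊆ = partition-horizontal⇒ covered₀ (n * m) covered-cofinite
    core : Core
    core = λ′ ,
      closed⇒core λ′ (⊆horizontal ∘ covered+m ∘ horizontal⊆) ,
      closed⇒core λ′ (⊆horizontal ∘ covered+n ∘ horizontal⊆) ,
      closed⇒core λ′ (λ {x} h → subst (λ z → Horizontal λ′ (x + z)) (sym m+2d≡n+d)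
        (⊆horizontal (covered+[n+d] (horizontal⊆ h))))

  cores-enumerated : HasCardinality (simultaneousCores m n (m + 2 * d)) (length closedWords)
  cores-enumerated = enumerate (simultaneousCores m n (m + 2 * d)) closedWords-unique word
    (λ {x} {y} → word-cong {x} {y}) (λ {x} {y} → word-injective {x} {y}) word∈closedWords word-onto

  length-closedWords-formula :
    length closedWords * n ≡ ∑[0≤ i ≤ ⌊ m /2⌋ ] multinomial n i (i + d) (m ∸ 2 * i)
  length-closedWords-formula = trans length-closedWords length-balancedWords

theorem1p6 : ∀ (m d : ℕ) .{{_ : NonZero m}} .{{_ : NonZero d}} → Coprime m d →
    ∃[ N ] HasCardinality (simultaneousCores m (m + d) (m + 2 * d)) N ×
    (+ N) / 1 ≡ (1ℤ / (m + d)) ℚ.* ((+ (∑[0≤ i ≤ ⌊ m /2⌋ ] multinomial (m + d) i (i + d) (m ∸ 2 * i))) / 1)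
theorem1p6 m d coprime =
  length closedWords , cores-enumerated , /1≡1/*/1 (length closedWords) (m + d) length-closedWords-formula
  where
  open Cores m d coprime
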